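{- Let $\mathbb{PR}$ be a nontrivial projective rectangle with special point $D$. For any three distinct points $d,e,f$ of $\mathbb{PR}$ that lie on a common ordinary line, and for any three distinct collinear points $d,e,f$ of $\mathbb{PR}$ one of which is the special point $D$, the harmonic conjugate of $e$ with respect to $d$ and $f$ exists.
   Context: An incidence structure is a triple $(\mathcal P,\mathcal L,\mathcal I)$ of sets with $\mathcal I\subseteq\mathcal P\times\mathcal L$ (points, lines, incidence). A projective rectangle is an incidence structure such that: (A1) every two distinct points are incident with exactly one line; (A2) there exist four points, no three of them collinear; (A3) every line is incident with at least three distinct points; (A4) there is a special point $D$; a line incident with $D$ is called special, a line not incident with $D$ is called ordinary, and a point other than $D$ is called ordinary; (A5) each special line intersects every other line in exactly one point; (A6) if two ordinary lines $l_1,l_2$ intersect in a point, then every two lines that intersect both $l_1$ and $l_2$ in four distinct points intersect in a point. A projective rectangle is nontrivial if it is not a projective plane. A projective rectangle is regarded as a rank-3 simple matroid whose rank-2 flats are determined by its lines. Harmonic configuration: let $d,e,f$ be three distinct points on a line $l$. Four further points $a_1,a_2,a_3,a_4$, none on $l$ and no three of them collinear, form with $d,e,f$ a harmonic configuration $\mathrm{HP}(d,e,f;a_1,a_2,a_3,a_4)$ based on $(d,e,f)$ if $\{d,a_1,a_2\}$, $\{d,a_4,a_3\}$, $\{e,a_4,a_2\}$, $\{f,a_4,a_1\}$, $\{f,a_3,a_2\}$ are collinear ($\{a_1,e,a_3\}$ may or may not be collinear). The harmonic conjugate of $e$ with respect to $d$ and $f$ exists, and equals $h$, if there is at least one harmonic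 configuration based on $(d,e,f)$, and for every harmonic configuration $\mathrm{HP}(d,e,f;a_1,a_2,a_3,a_4)$ the line through $a_1,a_3$ meets the line $l$ in a point, this point being the same point $h$ for all such configurations ($h=e$ is allowed). -}

module Defs where

open import Level using (Level; _⊔_; suc)
open import Data.Product using (_×_; ∃; ∃!; ∃-syntax)
open import Relation.Binary.PropositionalEquality using (_≡_; _≢_)
open import Relation.Nullary using (¬_)

record IncidenceStructure (p ℓ i : Level) : Set (suc (p ⊔ ℓ ⊔ i)) where
  infix 4 _I_
  field
    Point : Set p
    Line  : Set ℓ
    _I_   : Point → Line → Set i

  Collinear : Point → Point → Point → Set (ℓ ⊔ i)
  Collinear x y z = ∃[ l ] (x I l × y I l × z I l)

  Distinct₃ : Point → Point → Point → Set p
  Distinct₃ x y z = x ≢ y × x ≢ z × y ≢ z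

  -- Distinctness is stated separately: without it, a single point and no lines
  -- would count as four points, no three of them collinear.
  record Quadrangle (a₁ a₂ a₃ a₄ : Point) : Set (p ⊔ ℓ ⊔ i) where
    field
      a₁≢a₂ : a₁ ≢ a₂
      a₁≢a₃ : a₁ ≢ a₃
      a₁≢a₄ : a₁ ≢ a₄
      a₂≢a₃ : a₂ ≢ a₃
      a₂≢a₄ : a₂ ≢ a₄
      a₃≢a₄ : a₃ ≢ a₄
      ¬a₁a₂a₃ : ¬ Collinear a₁ a₂ a₃
      ¬a₁a₂a₄ : ¬ Collinear a₁ a₂ a₄
      ¬a₁a₃a₄ : ¬ Collinear a₁ a₃ a₄
      ¬a₂a₃a₄ : ¬ Collinear a₂ a₃ a₄

  Intersect : Line → Line → Set (p ⊔ i)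
  Intersect l m = ∃[ x ] (x I l × x I m)

  -- x is the one and only common point of l and m.
  MeetIn : Line → Line → Point → Set (p ⊔ i)
  MeetIn l m x = (x I l × x I m) × (∀ {y} → y I l × y I m → x ≡ y)

  record IsProjectivePlane : Set (p ⊔ ℓ ⊔ i) where
    field
      join       : ∀ {x y} → x ≢ y → ∃! _≡_ λ l → x I l × y I l
      meet       : ∀ {l m} → l ≢ m → ∃! _≡_ λ x → x I l × x I m
      quadrangle : ∃[ a₁ ] ∃[ a₂ ] ∃[ a₃ ] ∃[ a₄ ] Quadrangle a₁ a₂ a₃ a₄

  -- HP(d,e,f;a₁,a₂,a₃,a₄), where l is the line carrying d, e, f.
  record HarmonicConfiguration (l : Line) (d e f a₁ a₂ a₃ a₄ : Point) : Set (p ⊔ ℓ ⊔ i) where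
    field
      distinct   : Distinct₃ d e f
      d∈l        : d I l
      e∈l        : e I l
      f∈l        : f I l
      a₁∉l       : ¬ (a₁ I l)
      a₂∉l       : ¬ (a₂ I l)
      a₃∉l       : ¬ (a₃ I l)
      a₄∉l       : ¬ (a₄ I l)
      quadrangle : Quadrangle a₁ a₂ a₃ a₄
      da₁a₂      : Collinear d a₁ a₂
      da₄a₃      : Collinear d a₄ a₃
      ea₄a₂      : Collinear e a₄ a₂
      fa₄a₁      : Collinear f a₄ a₁
      fa₃a₂      : Collinear f a₃ a₂

  -- h is the harmonic conjugate of e with respect to d and f. The line m is
  -- unique whenever two distinct points lie on exactly one line.
  record IsHarmonicConjugate (l : Line) (d e f h : Point) : Set (p ⊔ ℓ ⊔ i) where
    field
      configuration : ∃[ a₁ ] ∃[ a₂ ] ∃[ a₃ ] ∃[ a₄ ] HarmonicConfiguration l d e f a₁ a₂ a₃ a₄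
      conjugate     : ∀ {a₁ a₂ a₃ a₄} → HarmonicConfiguration l d e f a₁ a₂ a₃ a₄ →
                      ∃[ m ] (a₁ I m × a₃ I m × MeetIn m l h)

  HarmonicConjugateExists : Line → Point → Point → Point → Set (p ⊔ ℓ ⊔ i)
  HarmonicConjugateExists l d e f = ∃[ h ] IsHarmonicConjugate l d e f h

record ProjectiveRectangle (p ℓ i : Level) : Set (suc (p ⊔ ℓ ⊔ i)) where
  field
    incidenceStructure : IncidenceStructure p ℓ i

  open IncidenceStructure incidenceStructure public

  field
    A1 : ∀ {x y} → x ≢ y → ∃! _≡_ λ l → x I l × y I l
    A2 : ∃[ a₁ ] ∃[ a₂ ] ∃[ a₃ ] ∃[ a₄ ] Quadrangle a₁ a₂ a₃ a₄
    A3 : ∀ l → ∃[ x ] ∃[ y ] ∃[ z ] (Distinct₃ x y z × x I l × y I l × z I l)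
    -- (A4): the special point.
    D  : Point

  Special : Line → Set i
  Special l = D I l

  Ordinary : Line → Set i
  Ordinary l = ¬ Special l

  field
    A5 : ∀ {s l} → Special s → s ≢ l → ∃! _≡_ λ x → x I s × x I l
    -- x₁₁, x₁₂, x₂₁, x₂₂ are the four points in which m₁, m₂ intersect l₁, l₂.
    A6 : ∀ {l₁ l₂ m₁ m₂ x₁₁ x₁₂ x₂₁ x₂₂} →
         Ordinary l₁ → Ordinary l₂ → l₁ ≢ l₂ → Intersect l₁ l₂ →
         m₁ ≢ m₂ →
         x₁₁ I m₁ → x₁₁ I l₁ → x₁₂ I m₁ → x₁₂ I l₂ →
         x₂₁ I m₂ → x₂₁ I l₁ → x₂₂ I m₂ → x₂₂ I l₂ →
         x₁₁ ≢ x₁₂ → x₁₁ ≢ x₂₁ → x₁₁ ≢ x₂₂ →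
         x₁₂ ≢ x₂₁ → x₁₂ ≢ x₂₂ → x₂₁ ≢ x₂₂ →
         Intersect m₁ m₂

  Nontrivial : Set (p ⊔ ℓ ⊔ i)
  Nontrivial = ¬ IsProjectivePlane

{-# OPTIONS --safe #-}
module Submission where

-- A rectangle behaves like a projective space in which a subspace W of codimension 2 has been
-- collapsed to D: ordinary lines are the lines missing W, and a plane (which meets W in one point)
-- is spanned by any three noncollinear ordinary points. Nontriviality provides a point outside
-- every plane, so two configurations over the line l can be compared as in three-dimensional
-- space: perspectivities from ordinary points O between two planes through l fix l pointwise, and
-- compositions of two of them carry a₁, a₄ to arbitrary b₁, b₄ collinear with f, hence the whole
-- configuration a to b and the conjugate of a to that of b.
--
-- Two points need care. On the special line OD the perspectivity is not visible in the rectangle;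
-- it is recovered there from the images of lines, which requires four special lines. With three
-- special lines the planes are Fano planes, and the conjugate is e directly. If l is special, one
-- must know that planes sharing two points of l other than D share all their points of l; this
-- follows from the perspectivities with an ordinary axis.

open import Level using (Level; _⊔_; Lift; lift; lower) renaming (suc to lsuc)
open import Axiom.ExcludedMiddle using (ExcludedMiddle)
open import Data.Empty using (⊥; ⊥-elim)
open import Data.Fin using (Fin; zero; suc; punchIn; _<_)
open import Data.Fin.Properties using (any?; punchInᵢ≢i; punchIn-injective; <-cmp)
open import Data.Nat using (suc; s≤s)
open import Data.Product using (_×_; _,_; ∃; ∃!; ∃-syntax; proj₁; proj₂)
open import Data.Sum using (_⊎_; inj₁; inj₂)
open import Function using (case_of_)
open import Relation.Binary.Definitions using (tri<; tri≈; tri>)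
open import Relation.Binary.PropositionalEquality using (_≡_; _≢_; refl; sym; trans; subst; ≢-sym)
open import Relation.Nullary using (¬_; Dec; yes; no)
open import Relation.Nullary.Decidable using (map′)
open import Defs

-- (A6) is Veblen's axiom for ordinary lines only, so auxiliary points have to be chosen such that
-- the lines drawn through them miss `D`. Each unwanted special line excludes one point of an
-- ordinary line, and no choice has to avoid more than three special lines at once. Since an
-- ordinary line meets all special lines, in different points, four special lines suffice for every
-- choice; if there are fewer, ordinary lines have exactly three points. The line `a₁ a₄` of a
-- configuration may pass through `D`, and then no perspectivities are available that carry it to a
-- given position. For ordinary `l` it is then the line `D f`, and a perspectivity with center off
-- that line produces a configuration with the same conjugate and `a₁ a₄` ordinary. For special `l`
-- it happens only if `f` is `D`, a case that the symmetry between `d` and `f` turns into `d` = `D`.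

module Rectangle {ℓp ℓl ℓi : Level} (em : ExcludedMiddle (ℓp ⊔ ℓl ⊔ ℓi)) (PR : ProjectiveRectangle ℓp ℓl ℓi) where

  open ProjectiveRectangle PR renaming (Collinear to Col)

  private
    variable
      a b c o p′ q t u v w w₁ w₂ w₃ w₄ x y z : Point
      l m : Line

  infix 4 _≟_ _#_

  -- Collinearity and ordinary joins

  _≟_ : (x y : Point) → Dec (x ≡ y)
  x ≟ y = map′ lower lift (em {P = Lift (ℓp ⊔ ℓl ⊔ ℓi) (x ≡ y)})

  _I?_ : (x : Point) (l : Line) → Dec (x I l)
  x I? l = map′ lower lift (em {P = Lift (ℓp ⊔ ℓl ⊔ ℓi) (x I l)})

  col? : (x y z : Point) → Dec (Col x y z)
  col? x y z = map′ lower lift (em {P = Lift (ℓp ⊔ ℓl ⊔ ℓi) (Col x y z)})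

  uniq : x ≢ y → x I l → y I l → x I m → y I m → l ≡ m
  uniq x≢y xl yl xm ym with _ , _ , unique ← A1 x≢y = trans (sym (unique (xl , yl))) (unique (xm , ym))

  ∃-≢ : ∀ x → ∃[ y ] x ≢ y
  ∃-≢ x with a₁ , a₂ , _ , _ , Q ← A2 with x ≟ a₁
  ... | yes refl = a₂ , Quadrangle.a₁≢a₂ Q
  ... | no x≢a₁ = a₁ , x≢a₁

  -- Covers equal points as well, so that triples with a repeated point are collinear without a case
  -- distinction.
  joined : ∀ x y → ∃[ l ] (x I l × y I l)
  joined x y with x ≟ y
  ... | no x≢y with l , (xl , yl) , _ ← A1 x≢y = l , xl , yl
  joined x .x | yes refl with l , (xl , _) , _ ← A1 (proj₂ (∃-≢ x)) = l , xl , xl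

  -- The digits are the positions of the points in the resulting triple; a repeated digit, as in
  -- `c121`, marks a degenerate collinearity.
  c132 : Col x y z → Col x z y
  c132 (l , a , b , c) = l , a , c , b
  c213 : Col x y z → Col y x z
  c213 (l , a , b , c) = l , b , a , c
  c231 : Col x y z → Col y z x
  c231 (l , a , b , c) = l , b , c , a
  c312 : Col x y z → Col z x y
  c312 (l , a , b , c) = l , c , a , b
  c321 : Col x y z → Col z y x
  c321 (l , a , b , c) = l , c , b , a

  c121 : Col x y x
  c121 {x} {y} with l , xl , yl ← joined x y = l , xl , yl , xl
  c122 : Col x y y
  c122 = c231 c121
  c112 : Col x x y
  c112 = c132 c121

  col⇒I : x ≢ y → x I l → y I l → Col x y z → z I l
  col⇒I x≢y xl yl (m , xm , ym , zm) with refl ← uniq x≢y xl yl xm ym = zm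

  on-line : x ≢ y → Col x y a → Col x y b → Col x y c → Col a b c
  on-line x≢y (l , xl , yl , al) cb cc = l , al , col⇒I x≢y xl yl cb , col⇒I x≢y xl yl cc

  on-join : Col x y a → Col x y b → a ≢ b → Col a b c → Col x y c
  on-join {x} {y} xya xyb a≢b abc with x ≟ y
  ... | yes refl = c112
  ... | no x≢y = on-line a≢b (on-line x≢y xya xyb c121) (on-line x≢y xya xyb c122) abc

  cross : ¬ Col a b c → Col a b x → Col a c x → x ≡ a
  cross {a = a} {x = x} nc abx acx with x ≟ a
  ... | yes e = e
  ... | no x≢a = ⊥-elim (nc (on-line x≢a c122 (c312 abx) (c312 acx)))

  -- The join of x and y is ordinary; in particular x and y are ordinary and distinct.
  _#_ : Point → Point → Set (ℓl ⊔ ℓi)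
  x # y = ¬ Col D x y

  #? : ∀ x y → x # y ⊎ Col D x y
  #? x y with col? D x y
  ... | yes c = inj₂ c
  ... | no nc = inj₁ nc

  #-sym : x # y → y # x
  #-sym x#y c = x#y (c132 c)

  #⇒≢ : x # y → x ≢ y
  #⇒≢ x#y refl = x#y c122

  #⇒≢Dˡ : x # y → x ≢ D
  #⇒≢Dˡ x#y refl = x#y c112

  #⇒≢Dʳ : x # y → y ≢ D
  #⇒≢Dʳ x#y refl = x#y c121

  ord⇒# : Ordinary l → x I l → y I l → x ≢ y → x # y
  ord⇒# ord xl yl x≢y (m , Dm , xm , ym) with refl ← uniq x≢y xl yl xm ym = ord Dm

  #⇒ord : x # y → x I l → y I l → Ordinary l
  #⇒ord x#y xl yl Dl = x#y (_ , Dl , xl , yl)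

  line# : a # b → Col a b x → Col a b y → x ≢ y → x # y
  line# a#b (l , al , bl , xl) aby = ord⇒# (#⇒ord a#b al bl) xl (col⇒I (#⇒≢ a#b) al bl aby)

  -- Whether a join is ordinary depends only on the special lines of the two points, so an ordinary
  -- point can be replaced by another one on its special line.
  #-same : y ≢ D → Col D x y → x # z → y # z
  #-same y≢D Dxy x#z Dyz = x#z (on-line (λ e → y≢D (sym e)) c121 (c132 Dxy) Dyz)

  col-D : x ≢ D → Col D x y → Col D x z → Col D y z
  col-D x≢D = on-line (λ e → x≢D (sym e)) c121

  -- Veblen's axiom and points on ordinary lines

  _≟ˡ_ : (l m : Line) → Dec (l ≡ m)
  l ≟ˡ m = map′ lower lift (em {P = Lift (ℓp ⊔ ℓl ⊔ ℓi) (l ≡ m)})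

  -- (A6) without its genericity hypotheses: whenever they fail, a common point is visible.
  veblen : ∀ {a b c d o p q p′ q′} → a # b → c # d → Col a b o → Col c d o →
           Col a b p → Col c d p′ → p ≢ p′ → Col a b q → Col c d q′ → q ≢ q′ →
           ∃[ x ] (Col p p′ x × Col q q′ x)
  veblen {o = o} {p} {q} {p′} {q′} a#b c#d (l₁ , al , bl , ol) (l₂ , cl , dl , om) abp cdp′ p≢p′ abq cdq′ q≢q′
    with p ≟ q | p ≟ q′ | p′ ≟ q | p′ ≟ q′
  ... | yes refl | _ | _ | _ = p , c121 , c121
  ... | _ | yes refl | _ | _ = p , c121 , c122
  ... | _ | _ | yes refl | _ = p′ , c122 , c121
  ... | _ | _ | _ | yes refl = p′ , c122 , c122
  ... | no p≢q | no p≢q′ | no p′≢q | no p′≢q′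
    with m , pm , p′m ← joined p p′ | n , qn , q′n ← joined q q′ with l₁ ≟ˡ l₂ | m ≟ˡ n
  ... | _ | yes refl = p , c121 , (n , qn , q′n , pm)
  ... | yes refl | _ =
        p , c121 , (l₁ , col⇒I (#⇒≢ a#b) al bl abq , col⇒I (#⇒≢ c#d) cl dl cdq′ , col⇒I (#⇒≢ a#b) al bl abp)
  ... | no l₁≢l₂ | no m≢n
    with x , xm , xn ← A6 (#⇒ord a#b al bl) (#⇒ord c#d cl dl) l₁≢l₂ (o , ol , om) m≢n
           pm (col⇒I (#⇒≢ a#b) al bl abp) p′m (col⇒I (#⇒≢ c#d) cl dl cdp′)
           qn (col⇒I (#⇒≢ a#b) al bl abq) q′n (col⇒I (#⇒≢ c#d) cl dl cdq′)
           p≢p′ p≢q p≢q′ p′≢q p′≢q′ q≢q′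
    = x , (m , pm , p′m , xm) , (n , qn , q′n , xn)

  -- By (A5); the common point is not `D` because `a b` misses `D`. This supplies points on a
  -- prescribed special line.
  cut : a # b → t ≢ D → ∃[ z ] (Col a b z × Col D t z × z ≢ D)
  cut {a} {b} {t} a#b t≢D with l , al , bl ← joined a b | s , Ds , ts ← joined D t
    with z , (zs , zl) , _ ← A5 {s} {l} Ds (λ { refl → a#b (s , Ds , al , bl) })
    = z , (l , al , bl , zl) , (s , Ds , ts , zs) , λ { refl → a#b (l , zl , al , bl) }

  third : a # b → ∃[ t ] (Col a b t × t # a × t # b)
  third {a} {b} a#b with l , al , bl ← joined a b with x , y , z , (x≢y , x≢z , y≢z) , xl , yl , zl ← A3 l
    = choose
    where
    ok : ∀ {t} → t I l → t ≢ a → t ≢ b → ∃[ t ] (Col a b t × t # a × t # b)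
    ok tl t≢a t≢b = _ , (l , al , bl , tl) , ord⇒# (#⇒ord a#b al bl) tl al t≢a , ord⇒# (#⇒ord a#b al bl) tl bl t≢b
    choose : ∃[ t ] (Col a b t × t # a × t # b)
    choose with x ≟ a | x ≟ b | y ≟ a | y ≟ b
    ... | no x≢a | no x≢b | _ | _ = ok xl x≢a x≢b
    ... | _ | _ | no y≢a | no y≢b = ok yl y≢a y≢b
    ... | yes refl | _ | yes refl | _ = ⊥-elim (x≢y refl)
    ... | yes refl | _ | _ | yes refl = ok zl (λ e → x≢z (sym e)) (λ e → y≢z (sym e))
    ... | _ | yes refl | yes refl | _ = ok zl (λ e → y≢z (sym e)) (λ e → x≢z (sym e))
    ... | _ | yes refl | _ | yes refl = ⊥-elim (x≢y refl)

  -- Planes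

  -- Closure is demanded along ordinary lines only: a plane may contain ordinary points of a special
  -- line without containing the whole line. Intersections with special lines are recovered in
  -- `meet-in`.
  record Plane : Set (lsuc (ℓp ⊔ ℓl ⊔ ℓi)) where
    field
      Mem    : Point → Set (ℓp ⊔ ℓl ⊔ ℓi)
      D∈     : Mem D
      closed : Mem x → Mem y → x # y → Col x y z → Mem z
      meet   : Mem x → Mem y → x # y → Mem z → Mem w → z # w → ∃[ o ] (Col x y o × Col z w o)

  private
    variable
      π π′ π″ : Plane

  infix 4 _∈_ _∉_

  -- A record rather than a synonym of Mem, so that the plane can be inferred.
  record _∈_ (x : Point) (π : Plane) : Set (ℓp ⊔ ℓl ⊔ ℓi) where
    constructor mem
    field
      Mem : Plane.Mem π x

  _∉_ : Point → Plane → Set (ℓp ⊔ ℓl ⊔ ℓi)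
  x ∉ π = ¬ (x ∈ π)

  D∈ : D ∈ π
  D∈ {π} = mem (Plane.D∈ π)

  closed : x ∈ π → y ∈ π → x # y → Col x y z → z ∈ π
  closed {π = π} (mem x∈) (mem y∈) x#y xyz = mem (Plane.closed π x∈ y∈ x#y xyz)

  meet# : x ∈ π → y ∈ π → x # y → z ∈ π → w ∈ π → z # w → ∃[ o ] (o ∈ π × Col x y o × Col z w o)
  meet# {π = π} x∈@(mem x∈ₘ) y∈@(mem y∈ₘ) x#y (mem z∈ₘ) (mem w∈ₘ) z#w
    with o , xyo , zwo ← Plane.meet π x∈ₘ y∈ₘ x#y z∈ₘ w∈ₘ z#w = o , closed x∈ y∈ x#y xyo , xyo , zwo

  module Span₁ {x y z : Point} (x#y : x # y) (x#z : x # z) (nc : ¬ Col x y z) where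

    -- The ordinary lines joining the axis `x y` to the axis `x z`, completed by the axes and `D`.
    -- Closure along lines through `x` is the hard case, see `through-x`.
    data InSpan (w : Point) : Set (ℓp ⊔ ℓl ⊔ ℓi) where
      isD : w ≡ D → InSpan w
      on₁ : Col x y w → InSpan w
      on₂ : Col x z w → InSpan w
      via : Col x y a → Col x z b → a ≢ x → b ≢ x → a # b → Col a b w → InSpan w

    -- Projection from a point of the first axis to the second. In the case `via`, Veblen's axiom
    -- applies to the first axis and the joining line that carries `w`.
    hits₂ : InSpan w → Col x y a → a # w → ∃[ o ] (Col x z o × Col a w o)
    hits₂ (isD refl) _ a#w = ⊥-elim (#⇒≢Dʳ a#w refl)
    hits₂ (on₁ xyw) xya _ = x , c121 , on-line (#⇒≢ x#y) xya xyw c121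
    hits₂ (on₂ xzw) _ _ = _ , xzw , c122
    hits₂ (via xya′ xzb′ a′≢x b′≢x a′#b′ a′b′w) xya a#w
      with o , awo , xb′o ← veblen x#y a′#b′ xya′ c121 xya a′b′w (#⇒≢ a#w) c121 c122 (λ e → b′≢x (sym e))
      = o , on-line (λ e → b′≢x (sym e)) c121 (c132 xzb′) xb′o , awo

    apart₁ : w ≢ D → ∃[ a ] (Col x y a × a ≢ x × a # w)
    apart₁ {w} w≢D with #? y w
    ... | inj₁ y#w = y , c122 , (λ { refl → #⇒≢ x#y refl }) , y#w
    ... | inj₂ Dyw with t , xyt , t#x , t#y ← third x#y
        = t , xyt , #⇒≢ t#x , #-sym (#-same w≢D Dyw (#-sym t#y))

    axes-meet : Col x y a → Col x z a → a ≡ x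
    axes-meet = cross nc

    -- By Veblen's axiom at `x`, the line `a w` meets `a₀ q` in a point `r`, which is in the span;
    -- projecting `r` from `a` to the second axis exhibits `w` on a joining line.
    through : ∀ {a₀ b₀ q a w} → Col x y a₀ → Col x z b₀ → a₀ ≢ x → b₀ ≢ x → a₀ # b₀ → Col a₀ b₀ q →
              x # q → Col x q w → Col x y a → a ≢ x → a ≢ a₀ → a # w → InSpan w
    through {a₀} {b₀} {q} {a} {w} xya₀ xzb₀ a₀≢x b₀≢x a₀#b₀ a₀b₀q x#q xqw xya a≢x a≢a₀ a#w with col? x y w
    ... | yes xyw = on₁ xyw
    ... | no ¬xyw = found
      where
      ¬xyq : ¬ Col x y q
      ¬xyq xyq = ¬xyw (on-line (#⇒≢ x#q) c121 (c132 xyq) xqw)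
      q≢a₀ : q ≢ a₀
      q≢a₀ refl = ¬xyq xya₀
      found : InSpan w
      found with r , qa₀r , war ← veblen x#q x#y c121 c121 c122 xya₀ q≢a₀ xqw xya (λ e → #⇒≢ a#w (sym e))
        with r∈ ← via xya₀ xzb₀ a₀≢x b₀≢x a₀#b₀ (on-line q≢a₀ c122 (c312 a₀b₀q) qa₀r)
        with a#r ← line# a#w c121 (c213 war) (λ { refl → ¬xyq (on-join xya xya₀ a≢a₀ (c321 qa₀r)) })
        with o , xzo , aro ← hits₂ r∈ xya a#r
        with awo ← on-line (#⇒≢ a#r) c121 (on-line (#⇒≢ a#w) c121 (c213 war) c122) aro
        = via xya xzo a≢x (λ { refl → ¬xyw (on-line a≢x c122 (c312 xya) (c132 awo)) }) (line# a#r c121 aro (λ { refl → a≢x (axes-meet xya xzo) })) (c132 awo)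

  module Span₂ {x y z : Point} (x#y : x # y) (x#z : x # z) (nc : ¬ Col x y z) where

    open Span₁ x#y x#z nc public
    private
      module Sw = Span₁ x#z x#y (λ c → nc (c132 c))

    swap : InSpan w → Sw.InSpan w
    swap (isD e) = Sw.isD e
    swap (on₁ c) = Sw.on₂ c
    swap (on₂ c) = Sw.on₁ c
    swap (via ca cb a≢x b≢x a#b c) = Sw.via cb ca b≢x a≢x (#-sym a#b) (c213 c)

    hits₁ : InSpan w → Col x z b → b # w → ∃[ o ] (Col x y o × Col b w o)
    hits₁ w∈ = Sw.hits₂ (swap w∈)

    Meets₁ Meets₂ : Point → Point → Set (ℓp ⊔ ℓl ⊔ ℓi)
    Meets₁ w₁ w₂ = ∃[ a ] (Col x y a × Col w₁ w₂ a)
    Meets₂ w₁ w₂ = ∃[ b ] (Col x z b × Col w₁ w₂ b)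

    meets₁⇒meets₂ : InSpan w₁ → InSpan w₂ → w₁ # w₂ → Meets₁ w₁ w₂ → Meets₂ w₁ w₂
    meets₁⇒meets₂ {w₁} {w₂} w₁∈ w₂∈ w₁#w₂ (a , xya , wa) with a ≟ w₁
    ... | yes refl = hits₂ w₂∈ xya w₁#w₂
    ... | no a≢w₁ with o , xzo , awo ← hits₂ w₁∈ xya (line# w₁#w₂ wa c121 a≢w₁)
        = o , xzo , on-line a≢w₁ c122 (c312 wa) awo

    meets₂⇒meets₁ : InSpan w₁ → InSpan w₂ → w₁ # w₂ → Meets₂ w₁ w₂ → Meets₁ w₁ w₂
    meets₂⇒meets₁ {w₁} {w₂} w₁∈ w₂∈ w₁#w₂ (b , xzb , wb) with b ≟ w₁
    ... | yes refl = hits₁ w₂∈ xzb w₁#w₂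
    ... | no b≢w₁ with o , xyo , bwo ← hits₁ w₁∈ xzb (line# w₁#w₂ wb c121 b≢w₁)
        = o , xyo , on-line b≢w₁ c122 (c312 wb) bwo

    -- Project `w₁` from a point `a` of the first axis to `u` on the second. If `w₂` can be
    -- projected from `a` too, Veblen's axiom makes `w₁ w₂` meet the second axis. If `a w₂` is
    -- special, `w₂` is projected from `u` back to the first axis, and the meeting point falls
    -- there; hence the disjunction.
    meets-one : InSpan w₁ → InSpan w₂ → w₁ # w₂ → Meets₁ w₁ w₂ ⊎ Meets₂ w₁ w₂
    meets-one {w₁} {w₂} w₁∈ w₂∈ w₁#w₂ with col? x y w₁ | col? x z w₁
    ... | yes c | _ = inj₁ (w₁ , c , c121)
    ... | _ | yes c = inj₂ (w₁ , c , c121)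
    ... | no ¬xyw₁ | no ¬xzw₁
      with a , xya , a≢x , a#w₁ ← apart₁ (#⇒≢Dˡ w₁#w₂)
      with u , xzu , aw₁u ← hits₂ w₁∈ xya a#w₁
      with a≢u ← (λ { refl → a≢x (axes-meet xya xzu) }) with u≢w₁ ← (λ { refl → ¬xzw₁ xzu })
      with #? a w₂
    ... | inj₁ a#w₂ with v , xzv , aw₂v ← hits₂ w₂∈ xya a#w₂ with u ≟ v
    ...   | yes refl = inj₂ (u , xzu , on-line a≢u (c132 aw₁u) (c132 aw₂v) c122)
    ...   | no u≢v with o , wo , uvo ← veblen a#w₁ a#w₂ c121 c121 c122 c122 (#⇒≢ w₁#w₂) aw₁u aw₂v u≢v
            = inj₂ (o , on-join xzu xzv u≢v uvo , wo)
    meets-one {w₁} {w₂} w₁∈ w₂∈ w₁#w₂ | no ¬xyw₁ | no ¬xzw₁ | inj₂ Daw₂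
      with u#w₂ ← #-sym (#-same (#⇒≢Dʳ w₁#w₂) Daw₂ (line# a#w₁ c121 aw₁u a≢u))
      with v , xyv , uw₂v ← hits₁ w₂∈ xzu u#w₂ with a ≟ v
    ...   | yes refl = inj₁ (a , xya , on-line a≢u (c132 aw₁u) (c312 uw₂v) c121)
    ...   | no a≢v with o , wo , avo ← veblen (line# a#w₁ aw₁u c122 u≢w₁) u#w₂ c121 c121 c122 c122 (#⇒≢ w₁#w₂) (c321 aw₁u) uw₂v a≢v
            = inj₁ (o , on-join xya xyv a≢v avo , wo)

    meets₁ : InSpan w₁ → InSpan w₂ → w₁ # w₂ → Meets₁ w₁ w₂
    meets₁ w₁∈ w₂∈ w₁#w₂ with meets-one w₁∈ w₂∈ w₁#w₂
    ... | inj₁ m = m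
    ... | inj₂ m = meets₂⇒meets₁ w₁∈ w₂∈ w₁#w₂ m

    meets₂ : InSpan w₁ → InSpan w₂ → w₁ # w₂ → Meets₂ w₁ w₂
    meets₂ w₁∈ w₂∈ w₁#w₂ = meets₁⇒meets₂ w₁∈ w₂∈ w₁#w₂ (meets₁ w₁∈ w₂∈ w₁#w₂)

    through-x : InSpan q → x # q → Col x q w → InSpan w
    through-x {w = w} q∈ x#q xqw with w ≟ D
    ... | yes refl = isD refl
    through-x (isD refl) x#q xqw | no _ = ⊥-elim (#⇒≢Dʳ x#q refl)
    through-x (on₁ xyq) x#q xqw | no _ = on₁ (on-line (#⇒≢ x#q) c121 (c132 xyq) xqw)
    through-x (on₂ xzq) x#q xqw | no _ = on₂ (on-line (#⇒≢ x#q) c121 (c132 xzq) xqw)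
    through-x {q} {w} (via {a₀} {b₀} xya₀ xzb₀ a₀≢x b₀≢x a₀#b₀ a₀b₀q) x#q xqw | no w≢D
      with a , xa₀a , a#x , a#a₀ ← third (line# x#y c121 xya₀ (λ e → a₀≢x (sym e)))
      with xya ← on-line (λ e → a₀≢x (sym e)) c121 (c132 xya₀) xa₀a
      with #? a w
    ... | inj₁ a#w = through xya₀ xzb₀ a₀≢x b₀≢x a₀#b₀ a₀b₀q x#q xqw xya (#⇒≢ a#x) (#⇒≢ a#a₀) a#w
    -- Here `a` lies on the special line of `w`, so `a₀` does not, and the two exchange roles: `q`
    -- is replaced by the point `q′` of `x q` on a joining line `a b`, and `a₀` becomes the
    -- auxiliary point.
    ... | inj₂ Daw
      with b , xzb , b≢x , b#a ← Sw.apart₁ (#⇒≢Dˡ a#x)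
      with a₀#w ← #-sym (#-same w≢D Daw a#a₀)
      with r , a₀b₀r , abr ← veblen x#y x#z c121 c121 xya₀ xzb₀ (#⇒≢ a₀#b₀) xya xzb (#⇒≢ (#-sym b#a))
      with a≢r ← (λ { refl → b₀≢x (axes-meet (on-join xya xya₀ (#⇒≢ a#a₀) (c312 a₀b₀r)) xzb₀) })
      with q′ , arq′ , xqq′ ← veblen x#y a₀#b₀ xya₀ c121 xya a₀b₀r a≢r c121 a₀b₀q (#⇒≢ x#q)
      with abq′ ← on-line a≢r c121 (c132 abr) arq′
      with x≢q′ ← (λ { refl → b≢x (axes-meet (on-line (#⇒≢ a#x) c122 (c312 xya) (c132 abq′)) xzb) })
      = through xya xzb (#⇒≢ a#x) b≢x (#-sym b#a) abq′ (line# x#q c121 xqq′ x≢q′)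
          (on-line (#⇒≢ x#q) c121 xqq′ xqw) xya₀ a₀≢x (λ e → #⇒≢ a#a₀ (sym e)) a₀#w

    span-closed : InSpan w₁ → InSpan w₂ → w₁ # w₂ → Col w₁ w₂ w → InSpan w
    span-closed {w₁} {w₂} w₁∈ w₂∈ w₁#w₂ w₁w₂w
      with a , xya , wa ← meets₁ w₁∈ w₂∈ w₁#w₂ | b , xzb , wb ← meets₂ w₁∈ w₂∈ w₁#w₂ with a ≟ x | b ≟ x
    ... | no a≢x | no b≢x
        = via xya xzb a≢x b≢x (line# w₁#w₂ wa wb λ { refl → a≢x (axes-meet xya xzb) }) (on-line (#⇒≢ w₁#w₂) wa wb w₁w₂w)
    ... | yes refl | no b≢x = on₂ (on-line (λ e → b≢x (sym e)) c121 (c132 xzb) (on-line (#⇒≢ w₁#w₂) wa wb w₁w₂w))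
    ... | no a≢x | yes refl = on₁ (on-line (λ e → a≢x (sym e)) c121 (c132 xya) (on-line (#⇒≢ w₁#w₂) wb wa w₁w₂w))
    ... | yes refl | yes refl with w₁ ≟ x
    ...   | no w₁≢x = through-x w₁∈ (line# w₁#w₂ wa c121 (λ e → w₁≢x (sym e))) (on-line (#⇒≢ w₁#w₂) wa c121 w₁w₂w)
    ...   | yes refl = through-x w₂∈ w₁#w₂ w₁w₂w

    -- The joining line `a₀ b₀` of `q` meets `a₂ b₂` in a point `r`. Veblen's axiom for `a₀ b₀` and
    -- an axis which these two lines meet in different points then makes `x q` meet `a₂ b₂`.
    meet-x : ∀ {q a₂ b₂} → InSpan q → x # q → Col x y a₂ → Col x z b₂ → a₂ ≢ x → b₂ ≢ x →
             ∃[ o ] (Col x q o × Col a₂ b₂ o)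
    meet-x (isD refl) x#q = ⊥-elim (#⇒≢Dʳ x#q refl)
    meet-x (on₁ xyq) x#q xya₂ _ _ _ = _ , on-line (#⇒≢ x#y) c121 xyq xya₂ , c121
    meet-x (on₂ xzq) x#q _ xzb₂ _ _ = _ , on-line (#⇒≢ x#z) c121 xzq xzb₂ , c122
    meet-x {q} {a₂} {b₂} (via {a₀} {b₀} xya₀ xzb₀ a₀≢x b₀≢x a₀#b₀ a₀b₀q) x#q xya₂ xzb₂ a₂≢x b₂≢x
      with r , a₀b₀r , a₂b₂r ← veblen x#y x#z c121 c121 xya₀ xzb₀ (#⇒≢ a₀#b₀) xya₂ xzb₂ (λ { refl → a₂≢x (axes-meet xya₂ xzb₂) })
      with a₂ ≟ a₀ | b₂ ≟ b₀
    ... | yes refl | yes refl = q , c122 , a₀b₀q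
    ... | no a₂≢a₀ | _
      with a₂≢r ← (λ { refl → b₀≢x (axes-meet (on-join xya₂ xya₀ a₂≢a₀ (c312 a₀b₀r)) xzb₀) })
      with o , xqo , a₂ro ← veblen x#y a₀#b₀ xya₀ c121 c121 a₀b₀q (#⇒≢ x#q) xya₂ a₀b₀r a₂≢r
      = o , xqo , on-line a₂≢r c121 (c132 a₂b₂r) a₂ro
    ... | _ | no b₂≢b₀
      with b₂≢r ← (λ { refl → a₀≢x (axes-meet xya₀ (on-join xzb₂ xzb₀ b₂≢b₀ (c321 a₀b₀r))) })
      with o , xqo , b₂ro ← veblen x#z a₀#b₀ xzb₀ c122 c121 a₀b₀q (#⇒≢ x#q) xzb₂ a₀b₀r b₂≢r
      = o , xqo , on-line b₂≢r (c231 a₂b₂r) c121 b₂ro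

    meet-x′ : ∀ {a₂ b₂} → InSpan w₁ → InSpan w₂ → w₁ # w₂ → Col w₁ w₂ x →
              Col x y a₂ → Col x z b₂ → a₂ ≢ x → b₂ ≢ x → ∃[ o ] (Col w₁ w₂ o × Col a₂ b₂ o)
    meet-x′ {w₁} {w₂} w₁∈ w₂∈ w₁#w₂ wx xya₂ xzb₂ a₂≢x b₂≢x with w₁ ≟ x
    ... | yes refl = meet-x w₂∈ w₁#w₂ xya₂ xzb₂ a₂≢x b₂≢x
    ... | no w₁≢x with o , xwo , abo ← meet-x w₁∈ (line# w₁#w₂ wx c121 (λ e → w₁≢x (sym e))) xya₂ xzb₂ a₂≢x b₂≢x
        = o , on-line w₁≢x c121 (c132 wx) (c213 xwo) , abo

    span-meet : InSpan w₁ → InSpan w₂ → w₁ # w₂ → InSpan w₃ → InSpan w₄ → w₃ # w₄ →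
                ∃[ o ] (Col w₁ w₂ o × Col w₃ w₄ o)
    span-meet {w₁} {w₂} {w₃} {w₄} w₁∈ w₂∈ w₁#w₂ w₃∈ w₄∈ w₃#w₄
      with a₁ , xya₁ , wa₁ ← meets₁ w₁∈ w₂∈ w₁#w₂ | b₁ , xzb₁ , wb₁ ← meets₂ w₁∈ w₂∈ w₁#w₂
         | a₂ , xya₂ , wa₂ ← meets₁ w₃∈ w₄∈ w₃#w₄ | b₂ , xzb₂ , wb₂ ← meets₂ w₃∈ w₄∈ w₃#w₄
      with col? w₁ w₂ x | col? w₃ w₄ x
    ... | yes c₁ | yes c₂ = x , c₁ , c₂
    ... | yes c₁ | no ¬c₂
      with o , wo , abo ← meet-x′ w₁∈ w₂∈ w₁#w₂ c₁ xya₂ xzb₂ (λ { refl → ¬c₂ wa₂ }) (λ { refl → ¬c₂ wb₂ })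
      = o , wo , on-join wa₂ wb₂ (λ { refl → ¬c₂ (subst (Col _ _) (axes-meet xya₂ xzb₂) wa₂) }) abo
    ... | no ¬c₁ | yes c₂
      with o , wo , abo ← meet-x′ w₃∈ w₄∈ w₃#w₄ c₂ xya₁ xzb₁ (λ { refl → ¬c₁ wa₁ }) (λ { refl → ¬c₁ wb₁ })
      = o , on-join wa₁ wb₁ (λ { refl → ¬c₁ (subst (Col _ _) (axes-meet xya₁ xzb₁) wa₁) }) abo , wo
    ... | no ¬c₁ | no ¬c₂
      with a₁≢b₁ ← (λ { refl → ¬c₁ (subst (Col _ _) (axes-meet xya₁ xzb₁) wa₁) })
         | a₂≢b₂ ← (λ { refl → ¬c₂ (subst (Col _ _) (axes-meet xya₂ xzb₂) wa₂) })
      with o , o₁ , o₂ ← veblen x#y x#z c121 c121 xya₁ xzb₁ a₁≢b₁ xya₂ xzb₂ a₂≢b₂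
      = o , on-join wa₁ wb₁ a₁≢b₁ o₁ , on-join wa₂ wb₂ a₂≢b₂ o₂

    plane : Plane
    plane = record { Mem = InSpan ; D∈ = isD refl ; closed = span-closed ; meet = span-meet }

  -- Two special joins among the points would be the same line, against noncollinearity. So one
  -- point has ordinary joins to both others and can serve as the apex `x` of a span.
  three-ordinary : x ≢ D → y ≢ D → z ≢ D → ¬ Col x y z →
                   (x # y × x # z) ⊎ (y # x × y # z) ⊎ (z # x × z # y)
  three-ordinary {x} {y} {z} x≢D y≢D z≢D nc with #? x y | #? x z | #? y z
  ... | inj₁ x#y | inj₁ x#z | _ = inj₁ (x#y , x#z)
  ... | inj₁ x#y | _ | inj₁ y#z = inj₂ (inj₁ (#-sym x#y , y#z))
  ... | _ | inj₁ x#z | inj₁ y#z = inj₂ (inj₂ (#-sym x#z , #-sym y#z))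
  ... | inj₂ Dxy | inj₂ Dxz | _ = ⊥-elim (nc (on-line (λ e → x≢D (sym e)) c122 Dxy Dxz))
  ... | inj₂ Dxy | _ | inj₂ Dyz = ⊥-elim (nc (on-line (λ e → y≢D (sym e)) (c132 Dxy) c122 Dyz))
  ... | _ | inj₂ Dxz | inj₂ Dyz = ⊥-elim (nc (on-line (λ e → z≢D (sym e)) (c132 Dxz) (c132 Dyz) c122))

  plane-through : x ≢ D → y ≢ D → z ≢ D → ¬ Col x y z → ∃[ π ] (x ∈ π × y ∈ π × z ∈ π)
  plane-through {x} {y} {z} x≢D y≢D z≢D nc with three-ordinary x≢D y≢D z≢D nc
  ... | inj₁ (x#y , x#z) = plane , mem (on₁ c121) , mem (on₁ c122) , mem (on₂ c122)
    where open Span₂ x#y x#z nc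
  ... | inj₂ (inj₁ (y#x , y#z)) = plane , mem (on₁ c122) , mem (on₁ c121) , mem (on₂ c122)
    where open Span₂ y#x y#z (λ c → nc (c213 c))
  ... | inj₂ (inj₂ (z#x , z#y)) = plane , mem (on₁ c122) , mem (on₂ c122) , mem (on₁ c121)
    where open Span₂ z#x z#y (λ c → nc (c231 c))

  -- A point other than `D` and off `x y` lies on an ordinary line that meets `x y` and `x z` in
  -- different points, and these belong to both planes.
  plane-⊆# : x # y → x # z → ¬ Col x y z → x ∈ π → y ∈ π → z ∈ π → x ∈ π′ → y ∈ π′ → z ∈ π′ → w ∈ π → w ∈ π′
  plane-⊆# {x} {y} {z} {w = w} x#y x#z nc x∈ y∈ z∈ x∈′ y∈′ z∈′ w∈ with w ≟ D | col? x y w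
  ... | yes refl | _ = D∈
  ... | _ | yes xyw = closed x∈′ y∈′ x#y xyw
  ... | no w≢D | no ¬xyw
    with a , xya , a≢x , a#w ← Span₁.apart₁ x#y x#z nc w≢D
    with o , _ , awo , xzo ← meet# (closed x∈ y∈ x#y xya) w∈ a#w x∈ z∈ x#z
    with a≢o ← (λ { refl → a≢x (cross nc xya xzo) })
    = closed (closed x∈′ y∈′ x#y xya) (closed x∈′ z∈′ x#z xzo)
        (line# a#w c121 awo a≢o) (c132 awo)

  plane-⊆ : x ≢ D → y ≢ D → z ≢ D → ¬ Col x y z →
            x ∈ π → y ∈ π → z ∈ π → x ∈ π′ → y ∈ π′ → z ∈ π′ → w ∈ π → w ∈ π′
  plane-⊆ x≢D y≢D z≢D nc x∈ y∈ z∈ x∈′ y∈′ z∈′ with three-ordinary x≢D y≢D z≢D nc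
  ... | inj₁ (x#y , x#z) = plane-⊆# x#y x#z nc x∈ y∈ z∈ x∈′ y∈′ z∈′
  ... | inj₂ (inj₁ (y#x , y#z)) = plane-⊆# y#x y#z (λ c → nc (c213 c)) y∈ x∈ z∈ y∈′ x∈′ z∈′
  ... | inj₂ (inj₂ (z#x , z#y)) = plane-⊆# z#x z#y (λ c → nc (c231 c)) z∈ x∈ y∈ z∈′ x∈′ y∈′

  meet-in : x ≢ y → z ≢ w → x ∈ π → y ∈ π → z ∈ π → w ∈ π → ∃[ o ] (o ∈ π × Col x y o × Col z w o)
  meet-in {x} {y} {z} {w} x≢y z≢w x∈ y∈ z∈ w∈ with #? x y | #? z w
  ... | inj₁ x#y | inj₁ z#w = meet# x∈ y∈ x#y z∈ w∈ z#w
  ... | inj₂ Dxy | inj₂ Dzw = D , D∈ , c231 Dxy , c231 Dzw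
  ... | inj₁ x#y | inj₂ Dzw with z ≟ D
  ...   | no z≢D with o , xyo , Dzo , _ ← cut x#y z≢D
          = o , closed x∈ y∈ x#y xyo , xyo , on-line (λ e → z≢D (sym e)) c122 Dzw Dzo
  ...   | yes refl with o , xyo , Dwo , _ ← cut x#y (λ e → z≢w (sym e)) = o , closed x∈ y∈ x#y xyo , xyo , Dwo
  meet-in {x} {y} {z} {w} x≢y z≢w x∈ y∈ z∈ w∈ | inj₂ Dxy | inj₁ z#w with x ≟ D
  ...   | no x≢D with o , zwo , Dxo , _ ← cut z#w x≢D
          = o , closed z∈ w∈ z#w zwo , on-line (λ e → x≢D (sym e)) c122 Dxy Dxo , zwo
  ...   | yes refl with o , zwo , Dyo , _ ← cut z#w (λ e → x≢y (sym e)) = o , closed z∈ w∈ z#w zwo , Dyo , zwo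

  -- Available once there are four special lines, since they meet `a b` in different points and at
  -- most three of these are excluded.
  Pick : Set (ℓp ⊔ ℓl ⊔ ℓi)
  Pick = ∀ {a b x y z} → a # b → x ≢ D → y ≢ D → z ≢ D → ∃[ t ] (Col a b t × t # x × t # y × t # z)

  -- Perspectivities

  record Persp (π π′ : Plane) (O x x′ : Point) : Set (ℓp ⊔ ℓl ⊔ ℓi) where
    constructor persp
    field
      src : x ∈ π
      tgt : x′ ∈ π′
      src# : O # x
      tgt# : O # x′
      col : Col O x x′

  open Persp

  persp-sym : ∀ {O x x′} → Persp π π′ O x x′ → Persp π′ π O x′ x
  persp-sym (persp s t o o′ c) = persp t s o′ o (c132 c)

  -- The point w₀ is needed: a Plane may be degenerate, for instance contained in a special line.
  record Through (l : Line) (u v : Point) (π : Plane) : Set (ℓp ⊔ ℓl ⊔ ℓi) where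
    field
      u∈ : u ∈ π
      v∈ : v ∈ π
      {w₀} : Point
      w∈ : w₀ ∈ π
      w∉l : ¬ (w₀ I l)
      w≢D : w₀ ≢ D

  open Through

  -- All lines of a harmonic configuration, and the line from `a₁` and `a₃` to the conjugate, pass
  -- through points of `l`; so it is enough to preserve collinearity with a point of `l`. That this
  -- point is the same on both sides expresses that `l` is fixed pointwise.
  record Iso (l : Line) (π π′ : Plane) : Set (lsuc (ℓp ⊔ ℓl ⊔ ℓi)) where
    field
      rel : Point → Point → Set (ℓp ⊔ ℓl ⊔ ℓi)
      img : x ∈ π → ∃[ x′ ] (x′ ∈ π′ × rel x x′)
      pres : ∀ {x x′ y y′ z} → rel x x′ → rel y y′ → x ≢ y → z I l → z ∈ π → Col z x y → Col z x′ y′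
      offl : ∀ {x x′} → rel x x′ → ¬ (x I l) → ¬ (x′ I l)
      inj : ∀ {x x′ y y′} → rel x x′ → rel y y′ → x ≢ y → x′ ≢ y′

  open Iso

  -- `share` is a parameter because it is immediate for an ordinary axis, whereas its proof for a
  -- special axis uses this module with an ordinary one.
  module Axis (pick : Pick) (outside : ∀ π → ∃[ w ] w ∉ π) {l : Line} {u v : Point} (u≢v : u ≢ v) (u≢D : u ≢ D) (v≢D : v ≢ D)
    (ul : u I l) (vl : v I l)
    (share : ∀ {π π′ x} → Through l u v π → Through l u v π′ → x I l → x ∈ π → x ∈ π′) where

    Pencil : Plane → Set (ℓp ⊔ ℓl ⊔ ℓi)
    Pencil = Through l u v

    Dist : Plane → Plane → Set (ℓp ⊔ ℓl ⊔ ℓi)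
    Dist π π′ = ∀ {x} → x ∈ π → x ∈ π′ → x ≢ D → x I l

    move : Pencil π → Pencil π′ → x I l → x ∈ π → x ∈ π′
    move = share

    off : x I l → ¬ (y I l) → x ≢ y
    off xl y∉l refl = y∉l xl

    trace : Pencil π → x ≢ y → x ∈ π → y ∈ π → ∃[ z ] (z ∈ π × z I l × Col x y z)
    trace A x≢y x∈ y∈ with z , z∈ , xyz , uvz ← meet-in x≢y u≢v x∈ y∈ (u∈ A) (v∈ A)
      = z , z∈ , col⇒I u≢v ul vl uvz , xyz

    special-# : Special l → x I l → x ≢ D → ¬ (y I l) → x # y
    special-# sp xl x≢D y∉l Dxy = y∉l (col⇒I (λ e → x≢D (sym e)) sp xl Dxy)

    module Half {π π′ : Plane} (A : Pencil π) (A′ : Pencil π′)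
      {O p p′ : Point} (O∉π : O ∉ π) (O∉π′ : O ∉ π′) (pp′ : Persp π π′ O p p′)
      (p∉l : ¬ (p I l)) (p′∉l : ¬ (p′ I l)) where

      R : Point → Point → Set (ℓp ⊔ ℓl ⊔ ℓi)
      R = Persp π π′ O

      R-func : ∀ {x x′ x″} → R x x′ → R x x″ → x′ ≡ x″
      R-func {x} {x′} {x″} r r″ with x′ ≟ x″
      ... | yes e = e
      ... | no x′≢x″ = ⊥-elim (O∉π′ (closed (tgt r) (tgt r″) (line# (src# r) (col r) (col r″) x′≢x″)
                                   (on-line (#⇒≢ (src# r)) (col r) (col r″) c121)))

      R-fix : z I l → z ∈ π → O # z → R z z
      R-fix zl z∈ O#z = persp z∈ (move A A′ zl z∈) O#z O#z c122

      R-on : ∀ {x′} → x I l → R x x′ → x′ ≡ x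
      R-on xl r = R-func r (R-fix xl (src r) (src# r))

      R-off : ∀ {x x′} → R x x′ → x′ I l → x I l
      R-off {x} {x′} r x′l with x ≟ x′
      ... | yes refl = x′l
      ... | no x≢x′ = ⊥-elim (O∉π (closed (src r) (move A′ A x′l (tgt r)) (line# (src# r) c122 (col r) x≢x′) (c231 (col r))))

      -- A known pair `y`, `y′` determines the images on the line `z y`: Veblen's axiom at `y` makes
      -- `O x` meet `z y′`.
      step : ∀ {y y′ x z} → R y y′ → z I l → z ∈ π → z # y → z # y′ → Col z y x → x ∈ π → O # x → ∃[ x′ ] R x x′
      step {y} {y′} {x} {z} r zl z∈ z#y z#y′ zyx x∈ O#x
        with x′ , Oxx′ , zy′x′ ← veblen (src# r) z#y c122 c122 c121 zyx (#⇒≢ O#x) (col r) c121 (λ e → #⇒≢ z#y′ (sym e))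
        with x′∈ ← closed (move A A′ zl z∈) (tgt r) z#y′ (c213 zy′x′)
        = x′ , persp x∈ x′∈ O#x (line# O#x c121 Oxx′ (λ { refl → O∉π′ x′∈ })) Oxx′

      total-special : Special l → x ∈ π → O # x → ¬ (x I l) → ∃[ x′ ] R x x′
      total-special {x} sp x∈ O#x x∉l with x ≟ p
      ... | yes refl = p′ , pp′
      ... | no x≢p with #? x p
      ... | inj₁ x#p with z , z∈ , zl , xpz ← trace A x≢p x∈ (src pp′)
            with z≢D ← (λ { refl → x#p (c312 xpz) })
            = step pp′ zl z∈ (special-# sp zl z≢D p∉l) (special-# sp zl z≢D p′∉l) (c321 xpz) x∈ O#x
      -- The line `x p` is special and yields no image, so a detour is made through a point `t` of
      -- `u p`, whose image is found from `p`.
      ... | inj₂ Dxp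
            with u#p ← special-# sp ul u≢D p∉l
            with t , upt , t#u , t#O , t#p ← pick u#p u≢D (#⇒≢Dˡ O#x) (#⇒≢Dʳ u#p)
            with t∉l ← (λ tl → t#u (l , sp , tl , ul))
            with t∈ ← closed (u∈ A) (src pp′) u#p upt
            with t′ , tt′ ← step pp′ ul (u∈ A) u#p (special-# sp ul u≢D p′∉l) upt t∈ (#-sym t#O)
            with x#t ← #-same (#⇒≢Dʳ O#x) (c132 Dxp) (#-sym t#p)
            with z , z∈ , zl , xtz ← trace A (#⇒≢ x#t) x∈ t∈
            with z≢D ← (λ { refl → x#t (c312 xtz) })
            = step tt′ zl z∈ (special-# sp zl z≢D t∉l) (special-# sp zl z≢D (λ t′l → t∉l (R-off tt′ t′l))) (c321 xtz) x∈ O#x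

      -- Every point is reached through the line joining it to z₀ = l ∩ OD: images avoid OD,
      -- so the second step is never degenerate.
      total-ordinary : Ordinary l → x ∈ π → O # x → ¬ (x I l) → ∃[ x′ ] R x x′
      total-ordinary {x} ord x∈ O#x x∉l =
        case cut u#v (#⇒≢Dˡ O#x) of λ where
          (z₀ , uvz₀ , DOz₀ , z₀≢D) → case pick u#v (#⇒≢Dˡ O#x) (#⇒≢Dʳ (src# pp′)) (#⇒≢Dʳ (tgt# pp′)) of λ where
            (z , uvz , z#O , z#p , z#p′) →
              let zl = col⇒I u≢v ul vl uvz
                  z₀l = col⇒I u≢v ul vl uvz₀
                  z∈ = closed (u∈ A) (v∈ A) u#v uvz
                  z₀∈ = closed (u∈ A) (v∈ A) u#v uvz₀ in
              case meet-in (#⇒≢ z#p) (off z₀l x∉l) z∈ (src pp′) z₀∈ x∈ of λ where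
                (y , y∈ , zpy , z₀xy) →
                  let z≢z₀ : z ≢ z₀
                      z≢z₀ = λ { refl → z#O (c132 DOz₀) }
                      y≢z₀ : y ≢ z₀
                      y≢z₀ = λ { refl → p∉l (col⇒I z≢z₀ zl z₀l (c132 zpy)) }
                      O#y : O # y
                      O#y = λ DOy → O#x (on-join DOy DOz₀ y≢z₀ (c312 z₀xy)) in
                  case step pp′ zl z∈ z#p z#p′ zpy y∈ O#y of λ where
                    (y′ , yy′) → step yy′ z₀l z₀∈ (#-same z₀≢D DOz₀ O#y) (#-same z₀≢D DOz₀ (tgt# yy′)) (c132 z₀xy) x∈ O#x
        where
        u#v : u # v
        u#v = ord⇒# ord ul vl u≢v

      total : x ∈ π → O # x → ∃[ x′ ] R x x′
      total {x} x∈ O#x with x I? l | D I? l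
      ... | yes xl | _ = x , R-fix xl x∈ O#x
      ... | no x∉l | yes sp = total-special sp x∈ O#x x∉l
      ... | no x∉l | no ord = total-ordinary ord x∈ O#x x∉l

      -- If z, x′, y′ were not collinear, the planes O x y and π′ would share them and coincide.
      preserve# : ∀ {x x′ y y′ z} → R x x′ → R y y′ → z I l → z ∈ π → z # x → Col z x y → Col z x′ y′
      preserve# {x} {x′} {y} {y′} {z} r r′ zl z∈ z#x zxy with x ≟ y | col? z x′ y′
      ... | yes refl | _ with refl ← R-func r r′ = c122
      ... | _ | yes c = c
      ... | no x≢y | no nc
        with x#y ← line# z#x c122 zxy x≢y
        with Q , O∈Q , x∈Q , y∈Q ← plane-through (#⇒≢Dˡ (src# r)) (#⇒≢Dʳ (src# r)) (#⇒≢Dʳ (src# r′))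
               (λ Oxy → O∉π (closed (src r) (src r′) x#y (c231 Oxy)))
        = ⊥-elim (O∉π′ (plane-⊆ (#⇒≢Dˡ z#x) (#⇒≢Dʳ (tgt# r)) (#⇒≢Dʳ (tgt# r′)) nc
            (closed x∈Q y∈Q x#y (c231 zxy)) (closed O∈Q x∈Q (src# r) (col r)) (closed O∈Q y∈Q (src# r′) (col r′))
            (move A A′ zl z∈) (tgt r) (tgt r′) O∈Q))

      preserve-line# : ∀ {x x′ y y′ z} → R x x′ → R y y′ → z I l → z ∈ π → x # y → Col x y z → Col z x′ y′
      preserve-line# {x} {y = y} {z = z} r r′ zl z∈ x#y xyz with z ≟ x
      ... | no z≢x = preserve# r r′ zl z∈ (line# x#y xyz c121 z≢x) (c312 xyz)
      ... | yes refl = c132 (preserve# r′ r zl z∈ x#y c121 )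

    iso-trans : Pencil π → Pencil π′ → Iso l π π′ → Iso l π′ π″ → Iso l π π″
    iso-trans {π′ = π′} A A′ f g = record
      { rel = λ x x″ → ∃[ x′ ] (x′ ∈ π′ × rel f x x′ × rel g x′ x″)
      ; img = λ x∈ → let (x′ , x′∈ , fx) = img f x∈ ; (x″ , x″∈ , gx) = img g x′∈ in x″ , x″∈ , x′ , x′∈ , fx , gx
      ; pres = λ { (_ , _ , fx , gx) (_ , _ , fy , gy) x≢y zl z∈ c →
                   pres g gx gy (inj f fx fy x≢y) zl (move A A′ zl z∈) (pres f fx fy x≢y zl z∈ c) }
      ; offl = λ { (_ , _ , fx , gx) x∉l → offl g gx (offl f fx x∉l) }
      ; inj = λ { (_ , _ , fx , gx) (_ , _ , fy , gy) x≢y → inj g gx gy (inj f fx fy x≢y) }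
      }

    module Perspectivity {π π′ : Plane} (A : Pencil π) (A′ : Pencil π′) (dist : Dist π π′)
      {O p p′ : Point} (O∉π : O ∉ π) (O∉π′ : O ∉ π′) (pp′ : Persp π π′ O p p′)
      (p∉l : ¬ (p I l)) (p′∉l : ¬ (p′ I l)) where

      open Half A A′ O∉π O∉π′ pp′ p∉l p′∉l public
      private
        module Back = Half A′ A O∉π′ O∉π (persp-sym pp′) p′∉l p∉l

      O≢D : D ≢ O
      O≢D refl = #⇒≢Dˡ (src# pp′) refl

      R-inj : ∀ {x x′ y y′} → R x x′ → R y y′ → x ≢ y → x′ ≢ y′
      R-inj r r′ x≢y refl = x≢y (Back.R-func (persp-sym r) (persp-sym r′))

      -- The line x′ y′ meets l in a point collinear with x and y, which can only be z.
      preserve-special# : ∀ {x x′ y y′ z} → Ordinary l → R x x′ → R y y′ → z I l → z ≢ D →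
                          Col D z x → Col D z y → x′ # y′ → Col z x′ y′
      preserve-special# {x} {x′} {y} {y′} {z} ord r r′ zl z≢D Dzx Dzy x′#y′
        with g , g∈ , gl , x′y′g ← trace A′ (#⇒≢ x′#y′) (tgt r) (tgt r′)
        with gxy ← Back.preserve-line# (persp-sym r) (persp-sym r′) gl g∈ x′#y′ x′y′g
        with x≢y ← (λ { refl → #⇒≢ x′#y′ (R-func r r′) })
        with g ≟ z
      ... | yes refl = c312 x′y′g
      ... | no g≢z = ⊥-elim (ord (col⇒I g≢z gl zl (on-line x≢y (c231 gxy) (on-line D≢z Dzx Dzy c122) (on-line D≢z Dzx Dzy c121))))
        where
        D≢z : D ≢ z
        D≢z e = z≢D (sym e)

      -- If `x′ y′` is special, `x′` is replaced by another point `c` of `z x′`: the preimage `g` of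
      -- `c` is still on `D z`, and `c y′` is ordinary.
      preserve-special : ∀ {x x′ y y′ z} → Ordinary l → R x x′ → R y y′ → z I l → z ∈ π → z ≢ D → ¬ (x I l) →
                         Col D z x → Col D z y → Col z x′ y′
      preserve-special {x} {x′} {y} {y′} {z} ord r r′ zl z∈ z≢D x∉l Dzx Dzy with #? x′ y′
      ... | inj₁ x′#y′ = preserve-special# ord r r′ zl z≢D Dzx Dzy x′#y′
      ... | inj₂ Dx′y′
        with D≢z ← (λ e → z≢D (sym e))
        with x≢x′ ← (λ { refl → x∉l (dist (src r) (tgt r) (#⇒≢Dʳ (src# r))) })
        with z#x′ ← (λ Dzx′ → src# r (on-line x≢x′ (on-line D≢z Dzx Dzx′ c121) (c231 (col r)) c121))
        with c , zx′c , c#z , c#x′ , c#O ← pick z#x′ z≢D (#⇒≢Dʳ z#x′) (#⇒≢Dˡ (src# r))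
        with c∈ ← closed (move A A′ zl z∈) (tgt r) z#x′ zx′c
        with g , cg ← Back.total c∈ (#-sym c#O)
        with zxg ← Back.preserve# (persp-sym r) cg zl (move A A′ zl z∈) z#x′ zx′c
        with Dzg ← on-line (off zl x∉l) (c231 Dzx) c121 zxg
        with zcy′ ← preserve-special# ord (persp-sym cg) r′ zl z≢D Dzg Dzy
                      (#-sym (#-same (#⇒≢Dʳ (tgt# r′)) Dx′y′ (#-sym c#x′)))
        = on-line (#⇒≢ (#-sym c#z)) c121 (c132 zx′c) zcy′

      preserve-D : ∀ {x x′ y y′} → Special l → R x x′ → R y y′ → Col D x y → Col D x′ y′
      preserve-D {x} {x′} {y} {y′} sp r r′ Dxy with #? x′ y′
      ... | inj₂ c = c
      ... | inj₁ x′#y′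
        with g , g∈ , gl , x′y′g ← trace A′ (#⇒≢ x′#y′) (tgt r) (tgt r′)
        with gxy ← Back.preserve-line# (persp-sym r) (persp-sym r′) gl g∈ x′#y′ x′y′g
        with x≢y ← (λ { refl → #⇒≢ x′#y′ (R-func r r′) })
        with D≢g ← (λ { refl → x′#y′ (c312 x′y′g) })
        with xl ← col⇒I D≢g sp gl (on-line x≢y (c231 Dxy) (c231 gxy) c121)
           | yl ← col⇒I D≢g sp gl (on-line x≢y (c231 Dxy) (c231 gxy) c122)
        with refl ← R-on xl r | refl ← R-on yl r′
        = Dxy

      preserve : ∀ {x x′ y y′ z} → R x x′ → R y y′ → z I l → z ∈ π → Col z x y → Col z x′ y′
      preserve {x} {x′} {y} {y′} {z} r r′ zl z∈ zxy with #? z x | #? z y | z ≟ D | D I? l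
      ... | inj₁ z#x | _ | _ | _ = preserve# r r′ zl z∈ z#x zxy
      ... | _ | inj₁ z#y | _ | _ = c132 (preserve# r′ r zl z∈ z#y (c132 zxy))
      ... | _ | _ | yes refl | _ = preserve-D zl r r′ zxy
      ... | inj₂ Dzx | inj₂ Dzy | no z≢D | yes sp
        with D≢z ← (λ e → z≢D (sym e))
        with refl ← R-on (col⇒I D≢z sp zl Dzx) r | refl ← R-on (col⇒I D≢z sp zl Dzy) r′ = zxy
      ... | inj₂ Dzx | inj₂ Dzy | no z≢D | no ord with x I? l
      ...   | no x∉l = preserve-special ord r r′ zl z∈ z≢D x∉l Dzx Dzy
      ...   | yes xl with x ≟ z
      ...     | yes refl with refl ← R-on xl r = c112
      ...     | no x≢z = ⊥-elim (ord (col⇒I x≢z xl zl (c321 Dzx)))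

    -- Extending a perspectivity to the special line through its center

    module Extension {π π′ : Plane} (A : Pencil π) (A′ : Pencil π′) (dist : Dist π π′)
      {O p p′ : Point} (O∉π : O ∉ π) (O∉π′ : O ∉ π′) (pp′ : Persp π π′ O p p′)
      (p∉l : ¬ (p I l)) (p′∉l : ¬ (p′ I l)) where

      open Perspectivity A A′ dist O∉π O∉π′ pp′ p∉l p′∉l public
      private
        module Back = Perspectivity A′ A (λ x∈′ x∈ → dist x∈ x∈′) O∉π′ O∉π (persp-sym pp′) p′∉l p∉l

      -- `R` is empty on the line `O D`. There an image is specified through lines: by `lines` it
      -- lies on the image of each line that joins `x` to a point of `l` off `O D`.
      record S (x x′ : Point) : Set (ℓp ⊔ ℓl ⊔ ℓi) where
        field
          tgtˢ : x′ ∈ π′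
          DOx : Col D O x
          DOx′ : Col D O x′
          fix : x I l → x′ ≡ x
          offˢ : x′ I l → x I l
          lines : ∀ {y y′ z} → R y y′ → z I l → z ∈ π → O # z → Col z x y → Col z x′ y′

      open S

      E : Point → Point → Set (ℓp ⊔ ℓl ⊔ ℓi)
      E x x′ = R x x′ ⊎ S x x′

      trace-# : Col D O x → ¬ (x I l) → z I l → O # y → Col x y z → O # z
      trace-# DOx x∉l zl O#y xyz DOz = O#y (on-join DOz DOx (off zl x∉l) (c312 xyz))

      -- The images of two lines through x meet on OD: otherwise their common point is the image
      -- of a point of π off OD which lies on both lines.
      concur : ∀ {x x′ y y′ z z₁} → Col D O x → ¬ (x I l) → z₁ I l → z₁ ∈ π → O # z₁ → Col x p z₁ →
               Col D O x′ → Col z₁ p′ x′ → R y y′ → z I l → z ∈ π → O # z → Col z x y → Col z x′ y′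
      concur {x} {x′} {y} {y′} {z} {z₁} DOx x∉l z₁l z₁∈ O#z₁ xpz₁ DOx′ z₁p′x′ r zl z∈ O#z zxy with y I? l | z ≟ z₁
      ... | yes yl | _ with refl ← R-on yl r with y ≟ z
      ...   | yes refl = c121
      ...   | no y≢z = ⊥-elim (x∉l (col⇒I y≢z yl zl (c312 zxy)))
      concur {x} {x′} {y} {y′} {z} {z₁} DOx x∉l z₁l z₁∈ O#z₁ xpz₁ DOx′ z₁p′x′ r zl z∈ O#z zxy | no _ | yes refl
        = on-line (off z₁l p′∉l) c121 z₁p′x′ (preserve pp′ r zl z∈ (on-line (off z₁l x∉l) c121 (c312 xpz₁) zxy))
      concur {x} {x′} {y} {y′} {z} {z₁} DOx x∉l z₁l z₁∈ O#z₁ xpz₁ DOx′ z₁p′x′ r zl z∈ O#z zxy | no y∉l | no z≢z₁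
        with z∈′ ← move A A′ zl z∈ | z₁∈′ ← move A A′ z₁l z₁∈
        with z≢y′ ← off zl (λ y′l → y∉l (R-off r y′l))
        with k , k∈ , z₁p′k , zy′k ← meet-in (off z₁l p′∉l) z≢y′ z₁∈′ (tgt pp′) z∈′ (tgt r)
        with #? O k
      ... | inj₂ DOk with k ≟ x′
      ...   | yes refl = c132 zy′k
      ...   | no k≢x′ = ⊥-elim (O#z₁ (on-join DOk DOx′ k≢x′ (on-line (off z₁l p′∉l) z₁p′k z₁p′x′ c121)))
      concur {x} {x′} {y} {y′} {z} {z₁} DOx x∉l z₁l z₁∈ O#z₁ xpz₁ DOx′ z₁p′x′ r zl z∈ O#z zxy | no y∉l | no z≢z₁ | inj₁ O#k
        with c , kc ← Back.total k∈ O#k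
        with z₁pc ← Back.preserve (persp-sym pp′) kc z₁l z₁∈′ z₁p′k
           | zyc ← Back.preserve (persp-sym r) kc zl z∈′ zy′k
        with c ≟ x
      ... | yes refl = ⊥-elim (tgt# kc DOx)
      ... | no c≢x = ⊥-elim (x∉l (col⇒I z≢z₁ zl z₁l (on-line c≢x
                       (on-line (off zl y∉l) zyc (c132 zxy) c121) (on-line (off z₁l p∉l) z₁pc (c321 xpz₁) c121) c122)))

      extend-on : x ∈ π → Col D O x → x I l → S x x
      extend-on x∈ DOx xl = record
        { tgtˢ = move A A′ xl x∈ ; DOx = DOx ; DOx′ = DOx ; fix = λ _ → refl ; offˢ = λ _ → xl
        ; lines = λ r zl _ O#z zxy → line-on r zl O#z zxy }
        where
        line-on : ∀ {y y′ z} → R y y′ → z I l → O # z → Col z _ y → Col z _ y′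
        line-on r zl O#z zxy with refl ← R-on (col⇒I (λ { refl → O#z DOx }) zl xl zxy) r = zxy

      project : ∀ {z} → z I l → z ∈ π → ∃[ x′ ] (x′ ∈ π′ × Col z p′ x′ × Col D O x′)
      project {z} zl z∈ with #? z p′
      ... | inj₂ Dzp′ = D , D∈ , c231 Dzp′ , c121
      ... | inj₁ z#p′ with x′ , c , c′ , _ ← cut z#p′ (#⇒≢Dˡ (src# pp′))
          = x′ , closed (move A A′ zl z∈) (tgt pp′) z#p′ c , c , c′

      -- The image is read off a single line, the one through `p`, as a common point of `z₁ p′` and
      -- `O D`; `concur` makes all other lines agree with it.
      extend-off : x ∈ π → Col D O x → ¬ (x I l) → ∃[ x′ ] S x x′
      extend-off {x} x∈ DOx x∉l
        with z₁ , z₁∈ , z₁l , xpz₁ ← trace A (λ { refl → src# pp′ DOx }) x∈ (src pp′)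
        with O#z₁ ← trace-# DOx x∉l z₁l (src# pp′) xpz₁
        with x′ , x′∈ , z₁p′x′ , DOx′ ← project z₁l z₁∈
        = x′ , record
        { tgtˢ = x′∈ ; DOx = DOx ; DOx′ = DOx′ ; fix = λ xl → ⊥-elim (x∉l xl)
        ; offˢ = λ x′l → ⊥-elim (p′∉l (col⇒I (λ { refl → O#z₁ DOx′ }) z₁l x′l (c132 z₁p′x′)))
        ; lines = concur DOx x∉l z₁l z₁∈ O#z₁ xpz₁ DOx′ z₁p′x′ }

      E-img : x ∈ π → ∃[ x′ ] (x′ ∈ π′ × E x x′)
      E-img {x} x∈ with #? O x | x I? l
      ... | inj₁ O#x | _ with x′ , r ← total x∈ O#x = x′ , tgt r , inj₁ r
      ... | inj₂ DOx | yes xl = x , move A A′ xl x∈ , inj₂ (extend-on x∈ DOx xl)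
      ... | inj₂ DOx | no x∉l with x′ , s ← extend-off x∈ DOx x∉l = x′ , tgtˢ s , inj₂ s

      SR-pres : ∀ {x x′ y y′ z} → S x x′ → R y y′ → z I l → z ∈ π → Col z x y → Col z x′ y′
      SR-pres {x} {z = z} s r zl z∈ zxy with #? O z | z ≟ x
      ... | inj₁ O#z | _ = lines s r zl z∈ O#z zxy
      ... | _ | yes refl with refl ← fix s zl = c112
      ... | inj₂ DOz | no z≢x = ⊥-elim (src# r (on-join DOz (DOx s) z≢x zxy))

      E-pres : ∀ {x x′ y y′ z} → E x x′ → E y y′ → x ≢ y → z I l → z ∈ π → Col z x y → Col z x′ y′
      E-pres (inj₁ r) (inj₁ r′) _ zl z∈ c = preserve r r′ zl z∈ c
      E-pres (inj₂ s) (inj₁ r) _ zl z∈ c = SR-pres s r zl z∈ c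
      E-pres (inj₁ r) (inj₂ s) _ zl z∈ c = c132 (SR-pres s r zl z∈ (c132 c))
      E-pres (inj₂ s) (inj₂ s′) x≢y zl z∈ c = on-line O≢D (on-join (DOx s) (DOx s′) x≢y (c231 c)) (DOx′ s) (DOx′ s′)

      E-off : ∀ {x x′} → E x x′ → ¬ (x I l) → ¬ (x′ I l)
      E-off (inj₁ r) x∉l x′l = x∉l (R-off r x′l)
      E-off (inj₂ s) x∉l x′l = x∉l (offˢ s x′l)

      S-inj : ∀ {x y x′} → x ∈ π → y ∈ π → S x x′ → S y x′ → x ≡ y
      S-inj {x} {y} x∈ y∈ s s′ with x I? l | y I? l | x ≟ y
      ... | _ | _ | yes e = e
      ... | yes xl | _ | _ with refl ← fix s xl = fix s′ (offˢ s′ xl)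
      ... | _ | yes yl | _ with refl ← fix s′ yl = sym (fix s (offˢ s yl))
      ... | no x∉l | no y∉l | no x≢y
        with z₁ , z₁∈ , z₁l , xpz₁ ← trace A (λ { refl → src# pp′ (DOx s) }) x∈ (src pp′)
           | z₂ , z₂∈ , z₂l , ypz₂ ← trace A (λ { refl → src# pp′ (DOx s′) }) y∈ (src pp′)
        with O#z₁ ← trace-# (DOx s) x∉l z₁l (src# pp′) xpz₁ | O#z₂ ← trace-# (DOx s′) y∉l z₂l (src# pp′) ypz₂
        with c₁ ← lines s pp′ z₁l z₁∈ O#z₁ (c312 xpz₁) | c₂ ← lines s′ pp′ z₂l z₂∈ O#z₂ (c312 ypz₂)
        with z₁ ≟ z₂
      ... | yes refl = ⊥-elim (O#z₁ (on-join (DOx s) (DOx s′) x≢y (on-line (off z₁l p∉l) (c321 xpz₁) (c321 ypz₂) c121)))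
      ... | no z₁≢z₂ = ⊥-elim (p′∉l (col⇒I z₁≢z₂ z₁l z₂l (on-line (λ { refl → tgt# pp′ (DOx′ s) }) (c231 c₁) (c231 c₂) c122)))

      E-inj : ∀ {x x′ y y′} → x ∈ π → y ∈ π → E x x′ → E y y′ → x ≢ y → x′ ≢ y′
      E-inj _ _ (inj₁ r) (inj₁ r′) = R-inj r r′
      E-inj _ _ (inj₂ s) (inj₁ r) _ refl = tgt# r (DOx′ s)
      E-inj _ _ (inj₁ r) (inj₂ s) _ refl = tgt# r (DOx′ s)
      E-inj x∈ y∈ (inj₂ s) (inj₂ s′) x≢y refl = x≢y (S-inj x∈ y∈ s s′)

      iso : Iso l π π′
      -- Membership of the source is part of `rel` because `S` does not record it and `S-inj` uses
      -- it.
      iso = record { rel = λ x x′ → x ∈ π × E x x′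
                   ; img = λ x∈ → let (x′ , x′∈ , e) = E-img x∈ in x′ , x′∈ , x∈ , e
                   ; pres = λ { (_ , e) (_ , e′) → E-pres e e′ }
                   ; offl = λ { (_ , e) → E-off e }
                   ; inj = λ { (x∈ , e) (y∈ , e′) → E-inj x∈ y∈ e e′ } }

    -- Isomorphisms between the planes through an axis

    point-in : Pencil π → z I l → z ∈ π → z ≢ D → x ≢ D → y ≢ D →
               ∃[ c ] (c ∈ π × ¬ (c I l) × c # z × c # x × c # y)
    point-in {z = z} A zl z∈ z≢D x≢D y≢D with D I? l
    ... | yes sp with z#w ← special-# sp zl z≢D (w∉l A)
        with c , zwc , c#z , c#x , c#y ← pick z#w z≢D x≢D y≢D
        = c , closed z∈ (w∈ A) z#w zwc , (λ cl → c#z (l , sp , cl , zl)) , c#z , c#x , c#y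
    -- A suitable special line is found through a point `t` of `l`. The point sought is `w₀` if it
    -- lies on that line, and otherwise the point where the line meets `h w₀`, for another point `h`
    -- of `l`.
    ... | no ord with u#v ← ord⇒# ord ul vl u≢v
        with t , uvt , t#z , t#x , t#y ← pick u#v z≢D x≢D y≢D
        with #? t (w₀ A)
    ... | inj₂ Dtw = w₀ A , w∈ A , w∉l A , #-same (w≢D A) Dtw t#z , #-same (w≢D A) Dtw t#x , #-same (w≢D A) Dtw t#y
    ... | inj₁ t#w with h , uvh , h#t , h#w , _ ← pick u#v (#⇒≢Dˡ t#z) (w≢D A) (w≢D A)
        with c , hwc , Dtc , c≢D ← cut h#w (#⇒≢Dˡ t#z)
        = c , closed (closed (u∈ A) (v∈ A) u#v uvh) (w∈ A) h#w hwc
          , (λ cl → w∉l A (col⇒I (λ { refl → h#t (c132 Dtc) }) (col⇒I u≢v ul vl uvh) cl (c132 hwc)))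
          , #-same c≢D Dtc t#z , #-same c≢D Dtc t#x , #-same c≢D Dtc t#y

    distinct : Pencil π → Pencil π′ → y ∈ π′ → y ∉ π → Dist π π′
    distinct A A′ y∈ y∉ {x} x∈ x∈′ x≢D with x I? l
    ... | yes xl = xl
    ... | no x∉l = ⊥-elim (y∉ (plane-⊆ u≢D v≢D x≢D (λ uvx → x∉l (col⇒I u≢v ul vl uvx))
                     (u∈ A′) (v∈ A′) x∈′ (u∈ A) (v∈ A) x∈ y∈))

    ordinary-⊆ : Pencil π → Ordinary l → x I l → x ∈ π
    ordinary-⊆ A ord xl = closed (u∈ A) (v∈ A) (ord⇒# ord ul vl u≢v) (l , ul , vl , xl)

    outside-off : Pencil π → ∃[ w ] (w ∉ π × ¬ (w I l))
    outside-off {π} A with w , w∉π ← outside π with w I? l | D I? l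
    ... | no ¬wl | _ = w , w∉π , ¬wl
    ... | yes wl | no ord = ⊥-elim (w∉π (ordinary-⊆ A ord wl))
    ... | yes wl | yes sp
      with t , wwt , t#w , t#w₀ ← third (special-# sp wl (λ { refl → w∉π D∈ }) (w∉l A))
      = t , (λ t∈ → w∉π (closed t∈ (w∈ A) t#w₀ (c321 wwt))) , λ tl → t#w (l , sp , tl , wl)

    pencil-through : x ≢ D → ¬ (x I l) → ∃[ π ] (Pencil π × x ∈ π)
    pencil-through x≢D x∉l with π , u∈π , v∈π , x∈π ← plane-through u≢D v≢D x≢D (λ uvx → x∉l (col⇒I u≢v ul vl uvx))
      = π , record { u∈ = u∈π ; v∈ = v∈π ; w∈ = x∈π ; w∉l = x∉l ; w≢D = x≢D } , x∈π

    off-axis : Pencil π → x # u → x ∉ π → ¬ (x I l)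
    off-axis A x#u x∉π xl with D I? l
    ... | yes sp = x#u (l , sp , xl , ul)
    ... | no ord = x∉π (ordinary-⊆ A ord xl)

    -- If the point found outside `π` lies in `π′`, the planes share only `D` and points of `l`, and
    -- a further point `O` of a line joining `π` to `π′` off the axis is in neither.
    third-plane : Pencil π → Pencil π′ → ∃[ π″ ] (Pencil π″ × Dist π π″ × Dist π″ π′)
    third-plane {π} {π′} A A′ with w , w∉π , ¬wl ← outside-off A with em {P = w ∈ π′}
    ... | no w∉π′ with π″ , A″ , w∈″ ← pencil-through (λ { refl → w∉π D∈ }) ¬wl
        = π″ , A″ , distinct A A″ w∈″ w∉π , λ x∈″ x∈′ → distinct A′ A″ w∈″ w∉π′ x∈′ x∈″
    ... | yes w∈π′
      with dist ← distinct A A′ w∈π′ w∉π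
      with p′ , p′∈ , p′∉l , p′#u , p′#p , _ ← point-in A′ ul (u∈ A′) u≢D (w≢D A) (w≢D A)
      with O , pp′O , O#u , O#p , O#p′ ← pick (#-sym p′#p) u≢D (w≢D A) (#⇒≢Dˡ p′#p)
      with O∉π ← (λ O∈ → p′∉l (dist (closed (w∈ A) O∈ (#-sym O#p) (c132 pp′O)) p′∈ (#⇒≢Dˡ p′#p)))
         | O∉π′ ← (λ O∈ → w∉l A (dist (w∈ A) (closed p′∈ O∈ (#-sym O#p′) (c231 pp′O)) (w≢D A)))
      with O∉l ← off-axis A O#u O∉π
      with π″ , A″ , O∈″ ← pencil-through (#⇒≢Dˡ O#u) O∉l
      = π″ , A″ , distinct A A″ O∈″ O∉π , λ x∈″ x∈′ → distinct A′ A″ O∈″ O∉π′ x∈′ x∈″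

    outside-join : Dist π π′ → p′ ∈ π′ → ¬ (p′ I l) → x ∈ π → x # p′ → Col x p′ o → o ≢ x → o ∉ π
    outside-join dist p′∈ p′∉l x∈ x#p′ xp′o o≢x o∈ =
      p′∉l (dist (closed x∈ o∈ (line# x#p′ c121 xp′o (λ e → o≢x (sym e))) (c132 xp′o)) p′∈ (#⇒≢Dʳ x#p′))

    module Center {π π′ : Plane} (A : Pencil π) (A′ : Pencil π′) (dist : Dist π π′) {p p′ O : Point}
      (p∈ : p ∈ π) (p∉l : ¬ (p I l)) (p′∈ : p′ ∈ π′) (p′∉l : ¬ (p′ I l))
      (p#p′ : p # p′) (pp′O : Col p p′ O) (O≢p : O ≢ p) (O≢p′ : O ≢ p′) where

      pp′ : Persp π π′ O p p′
      pp′ = persp p∈ p′∈ (line# p#p′ pp′O c121 O≢p) (line# p#p′ pp′O c122 O≢p′) (c312 pp′O)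

      O∉π : O ∉ π
      O∉π = outside-join dist p′∈ p′∉l p∈ p#p′ pp′O O≢p

      O∉π′ : O ∉ π′
      O∉π′ = outside-join (λ x∈′ x∈ → dist x∈ x∈′) p∈ p∉l p′∈ (#-sym p#p′) (c213 pp′O) O≢p′

      open Extension A A′ dist O∉π O∉π′ pp′ p∉l p′∉l public

      iso-p : rel iso p p′
      iso-p = p∈ , inj₁ pp′

      iso-special : ∀ {q q′ g} → q ∈ π → Col D O q → Col D O q′ → p ≢ q → g I l → g ∈ π → Col g p q → Col g p′ q′ → rel iso q q′
      iso-special {q} {q′} {g} q∈ DOq DOq′ p≢q gl g∈ gpq gp′q′ with E-img q∈
      ... | _ , _ , inj₁ r = ⊥-elim (src# r DOq)
      ... | q″ , _ , inj₂ s with q″ ≟ q′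
      ...   | yes refl = q∈ , inj₂ s
      ...   | no q″≢q′ = ⊥-elim (tgt# pp′ (on-join (S.DOx′ s) DOq′ q″≢q′
                (on-line (off gl p′∉l) (E-pres (inj₁ pp′) (inj₂ s) p≢q gl g∈ gpq) gp′q′ c122)))

      shifted : ∀ {g x x′} → g # O → g I l → ¬ (x I l) → x ≢ D → Col D g x → rel iso x x′ → ¬ Col D g x′
      shifted g#O gl x∉l x≢D Dgx (x∈ , inj₂ s) _ = #-same x≢D Dgx g#O (c132 (S.DOx s))
      shifted {x = x} {x′} g#O gl x∉l x≢D Dgx (x∈ , inj₁ r) Dgx′ =
        src# r (on-line x≢x′ (c231 (col-D (#⇒≢Dˡ g#O) Dgx Dgx′)) (c231 (col r)) c121)
        where
        x≢x′ : x ≢ x′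
        x≢x′ refl = x∉l (dist x∈ (tgt r) x≢D)

    -- The center is chosen off `D g`: a point of `D g` whose image were also on `D g` would put the
    -- center there. This serves to make `a₁ a₄` ordinary.
    shift : ∀ {g} → Pencil π → g I l → g ≢ D →
            ∃[ π′ ] (Pencil π′ × ∃[ φ ] (∀ {x x′} → ¬ (x I l) → x ≢ D → Col D g x → rel {l} {π} {π′} φ x x′ → ¬ Col D g x′))
    shift {g = g} A gl g≢D =
      case outside-off A of λ { (w , w∉π , ¬wl) →
      case pencil-through (λ { refl → w∉π D∈ }) ¬wl of λ { (π′ , A′ , w∈′) →
      case point-in A′ ul (u∈ A′) u≢D (w≢D A) (w≢D A) of λ { (p′ , p′∈ , p′∉l , p′#u , p′#p , _) →
      case pick (#-sym p′#p) g≢D (w≢D A) (#⇒≢Dˡ p′#p) of λ { (O , pp′O , O#g , O#p , O#p′) →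
        finish A A′ (distinct A A′ w∈′ w∉π) (w∈ A) (w∉l A) p′∈ p′∉l (#-sym p′#p) pp′O (#⇒≢ O#p) (#⇒≢ O#p′) (#-sym O#g)
      } } } }
      where
      finish : ∀ {p p′ O π π′} → Pencil π → Pencil π′ → Dist π π′ → p ∈ π → ¬ (p I l) → p′ ∈ π′ → ¬ (p′ I l) →
               p # p′ → Col p p′ O → O ≢ p → O ≢ p′ → g # O →
               ∃[ π′ ] (Pencil π′ × ∃[ φ ] (∀ {x x′} → ¬ (x I l) → x ≢ D → Col D g x → rel {l} {π} {π′} φ x x′ → ¬ Col D g x′))
      finish A A′ dist p∈ p∉l p′∈ p′∉l p#p′ pp′O O≢p O≢p′ g#O = _ , A′ , iso , λ {x} {x′} → shifted {x = x} {x′} g#O gl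
        where open Center A A′ dist p∈ p∉l p′∈ p′∉l p#p′ pp′O O≢p O≢p′

    -- As `p q` and `p′ q′` meet in `g`, Veblen's axiom gives the center as the intersection of
    -- `p p′` and `q q′`. If `q q′` is special, the center is where `D q` meets `p p′`, and the
    -- extension to `O D` takes care of `q`.
    iso₁ : ∀ {p q p′ q′ g} → Pencil π → Pencil π′ → Dist π π′ →
           p ∈ π → q ∈ π → ¬ (p I l) → ¬ (q I l) → p′ ∈ π′ → q′ ∈ π′ → ¬ (p′ I l) → ¬ (q′ I l) →
           g I l → g ∈ π → Col g p q → Col g p′ q′ → p # q → p′ # q′ → p # p′ →
           ∃[ f ] (rel {l} {π} {π′} f p p′ × rel f q q′)
    iso₁ {p = p} {q} {p′} {q′} {g} A A′ dist p∈ q∈ p∉l q∉l p′∈ q′∈ p′∉l q′∉l gl g∈ gpq gp′q′ p#q p′#q′ p#p′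
      with #? q q′
    ... | inj₁ q#q′
      with O , pp′O , qq′O ← veblen p#q p′#q′ (c231 gpq) (c231 gp′q′) c121 c121 (#⇒≢ p#p′) c122 c122 (#⇒≢ q#q′)
      with O≢p ← (λ { refl → q′∉l (dist (closed q∈ p∈ (#-sym p#q) (c132 qq′O)) q′∈ (#⇒≢Dʳ q#q′)) })
         | O≢p′ ← (λ { refl → q∉l (dist q∈ (closed q′∈ p′∈ (#-sym p′#q′) (c231 qq′O)) (#⇒≢Dˡ q#q′)) })
         | O≢q ← (λ { refl → p′∉l (dist (closed p∈ q∈ p#q (c132 pp′O)) p′∈ (#⇒≢Dʳ p#p′)) })
         | O≢q′ ← (λ { refl → p∉l (dist p∈ (closed p′∈ q′∈ p′#q′ (c231 pp′O)) (#⇒≢Dˡ p#p′)) })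
      = iso , iso-p , (q∈ , inj₁ (persp q∈ q′∈ (line# q#q′ qq′O c121 O≢q) (line# q#q′ qq′O c122 O≢q′) (c312 qq′O)))
      where open Center A A′ dist p∈ p∉l p′∈ p′∉l p#p′ pp′O O≢p O≢p′
    iso₁ {p = p} {q} {p′} {q′} {g} A A′ dist p∈ q∈ p∉l q∉l p′∈ q′∈ p′∉l q′∉l gl g∈ gpq gp′q′ p#q p′#q′ p#p′
        | inj₂ Dqq′
      with O , pp′O , DqO , O≢D ← cut p#p′ (#⇒≢Dʳ p#q)
      with O≢p ← (λ { refl → p#q (c132 DqO) })
         | O≢p′ ← (λ { refl → p′#q′ (col-D (#⇒≢Dʳ p#q) DqO Dqq′) })
      = iso , iso-p , iso-special q∈ (c132 DqO) (col-D (#⇒≢Dʳ p#q) DqO Dqq′) (#⇒≢ p#q) gl g∈ gpq gp′q′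
      where open Center A A′ dist p∈ p∉l p′∈ p′∉l p#p′ pp′O O≢p O≢p′

    -- `iso₁` asks for distinct planes and an ordinary `p p′`. A third plane, with a point `c` whose
    -- joins to `p` and `p′` are ordinary, covers equal planes and special `p p′` too.
    iso₂ : ∀ {p q p′ q′ g} → Pencil π → Pencil π′ →
           p ∈ π → q ∈ π → ¬ (p I l) → ¬ (q I l) → p′ ∈ π′ → q′ ∈ π′ → ¬ (p′ I l) → ¬ (q′ I l) →
           g I l → g ∈ π → Col g p q → Col g p′ q′ → p # q → p′ # q′ →
           ∃[ f ] (rel {l} {π} {π′} f p p′ × rel f q q′)
    iso₂ {p = p} {q} {p′} {q′} {g} A A′ p∈ q∈ p∉l q∉l p′∈ q′∈ p′∉l q′∉l gl g∈ gpq gp′q′ p#q p′#q′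
      with π″ , A″ , d , d′ ← third-plane A A′
      with g∈″ ← move A A″ gl g∈
      with g#p ← line# p#q (c231 gpq) c121 (off gl p∉l)
      with c , c∈ , c∉l , c#g , c#p , c#p′ ← point-in A″ gl g∈″ (#⇒≢Dˡ g#p) (#⇒≢Dˡ p#q) (#⇒≢Dˡ p′#q′)
      with k , cgk , k#c , k#g ← third c#g
      with k∈ ← closed c∈ g∈″ c#g cgk
      with k∉l ← (λ kl → c∉l (col⇒I (#⇒≢ k#g) kl gl (c321 cgk)))
      with f , fp , fq ← iso₁ A A″ d p∈ q∈ p∉l q∉l c∈ k∈ c∉l k∉l gl g∈ gpq (c213 cgk) p#q (#-sym k#c) (#-sym c#p)
      with f′ , fc , fk ← iso₁ A″ A′ d′ c∈ k∈ c∉l k∉l p′∈ q′∈ p′∉l q′∉l gl g∈″ (c213 cgk) gp′q′ (#-sym k#c) p′#q′ c#p′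
      = iso-trans A A″ f f′ , (c , c∈ , fp , fc) , (k , k∈ , fq , fk)

  -- Planes through two points of a special line

  share-ordinary : Ordinary l → u ≢ v → u I l → v I l → Through l u v π → Through l u v π′ → x I l → x ∈ π → x ∈ π′
  share-ordinary ord u≢v ul vl _ A′ xl _ = closed (u∈ A′) (v∈ A′) (ord⇒# ord ul vl u≢v) (_ , ul , vl , xl)

  -- In the projective space behind the rectangle, this is Desargues' theorem with its centre on the
  -- subspace collapsed to D: the special lines u v, z z₁ and z′ z₁′ carry parallel segments.
  module Parallel (pick : Pick) (outside : ∀ π → ∃[ w ] w ∉ π) {l k : Line} {α β : Plane} {u v y y′ z z₁ : Point}
    (sp : Special l) (ul : u I l) (vl : v I l) (z∉l : ¬ (z I l)) (y#y′ : y # y′) (yk : y I k) (y′k : y′ I k)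
    (yα : y ∈ α) (y′α : y′ ∈ α) (uα : u ∈ α) (yβ : y ∈ β) (y′β : y′ ∈ β) (vβ : v ∈ β)
    (u∉k : ¬ (u I k)) (v∉k : ¬ (v I k)) (u#y : u # y) (v#y : v # y) (u#z : u # z) (v#z₁ : v # z₁)
    (z≢y : z ≢ y) (z₁≢y : z₁ ≢ y) (uyz : Col u y z) (vyz₁ : Col v y z₁) (Dzz₁ : Col D z z₁) where

    private
      y≢y′ : y ≢ y′
      y≢y′ = #⇒≢ y#y′
      colₖ : x I k → Col y y′ x
      colₖ xk = k , yk , y′k , xk
      onk : Col y y′ x → x I k
      onk = col⇒I y≢y′ yk y′k
      inα : x I k → x ∈ α
      inα xk = closed yα y′α y#y′ (colₖ xk)
      z∉k : ¬ (z I k)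
      z∉k zk = u∉k (col⇒I z≢y zk yk (c321 uyz))
      z₁∉k : ¬ (z₁ I k)
      z₁∉k zk = v∉k (col⇒I z₁≢y zk yk (c321 vyz₁))

    abstract
      translation : ∃[ f ] (Iso.rel {k} {α} {β} f u v × Iso.rel f z z₁)
      translation = Axis.iso₂ pick outside y≢y′ (#⇒≢Dˡ y#y′) (#⇒≢Dʳ y#y′) yk y′k
        (share-ordinary (#⇒ord y#y′ yk y′k) y≢y′ yk y′k)
        (record { u∈ = yα ; v∈ = y′α ; w∈ = uα ; w∉l = u∉k ; w≢D = #⇒≢Dˡ u#y })
        (record { u∈ = yβ ; v∈ = y′β ; w∈ = vβ ; w∉l = v∉k ; w≢D = #⇒≢Dˡ v#y })
        uα (closed uα yα u#y uyz) u∉k z∉k vβ (closed vβ yβ v#y vyz₁) v∉k z₁∉k yk yα (c213 uyz) (c213 vyz₁) u#z v#z₁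

    private
      f : Iso k α β
      f = proj₁ translation
      fu : Iso.rel f u v
      fu = proj₁ (proj₂ translation)
      fz : Iso.rel f z z₁
      fz = proj₂ (proj₂ translation)

    foot : x ≢ D → ∃[ g ] (g I k × Col D x g × g ≢ D)
    foot x≢D with g , yy′g , Dxg , g≢D ← cut y#y′ x≢D = g , onk yy′g , Dxg , g≢D

    -- The special lines `u v` and `z z₁` each join a point to its image and meet the axis `k`, so
    -- the image of `D` lies on both; they are different lines.
    fixes-D : Iso.rel f D x → x ≡ D
    fixes-D {D*} fD with D ≟ D*
    ... | yes e = sym e
    ... | no D≢D* = case foot (#⇒≢Dˡ u#y) of λ { (U , Uk , DuU , U≢D) → case foot (#⇒≢Dʳ u#z) of λ { (Z , Zk , DzZ , Z≢D) →
      let D*l : D* I l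
          D*l = col⇒I (λ { refl → v∉k Uk }) (col⇒I (λ e → #⇒≢Dˡ u#y (sym e)) sp ul DuU) vl
                  (Iso.pres f fu fD (#⇒≢Dˡ u#y) Uk (inα Uk) (c321 DuU))
          DzD* : Col D z D*
          DzD* = on-join DzZ Dzz₁ (λ { refl → z₁∉k Zk }) (Iso.pres f fz fD (#⇒≢Dʳ u#z) Zk (inα Zk) (c321 DzZ))
      in ⊥-elim (z∉l (col⇒I D≢D* sp D*l (c132 DzD*))) } }

    -- The image of `z′` is the required point: the lines joining `z′` to `y′`, `P` and `D` all meet
    -- the axis `k`.
    parallel : ∀ {P z′} → P I k → u # y′ → z ≢ z′ → z′ ≢ u → z′ ≢ D → Col u y′ z′ → Col P z z′ →
               ∃[ z₁′ ] (Col v y′ z₁′ × Col D z′ z₁′ × Col P z₁ z₁′)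
    parallel {P} {z′} Pk u#y′ z≢z′ z′≢u z′≢D uy′z′ Pzz′ =
      finish (Iso.img f D∈) (Iso.img f (closed uα y′α u#y′ uy′z′)) (foot z′≢D)
      where
      finish : ∃[ x ] (x ∈ β × Iso.rel f D x) → ∃[ x ] (x ∈ β × Iso.rel f z′ x) → ∃[ g ] (g I k × Col D z′ g × g ≢ D) →
               ∃[ z₁′ ] (Col v y′ z₁′ × Col D z′ z₁′ × Col P z₁ z₁′)
      finish (D* , _ , fD) (ζ , _ , fz′) (K , Kk , Dz′K , K≢D) =
          ζ , c213 (Iso.pres f fu fz′ (λ e → z′≢u (sym e)) y′k y′α (c213 uy′z′))
          , on-line (λ e → K≢D (sym e)) c121 (c132 Dz′K) DKζ
          , Iso.pres f fz fz′ z≢z′ Pk (inα Pk) Pzz′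
        where
        DKζ : Col D K ζ
        DKζ = subst (λ x → Col x K ζ) (fixes-D fD) (c312 (Iso.pres f fz′ fD z′≢D Kk (inα Kk) (c321 Dz′K)))

  module Share (pick : Pick) (outside : ∀ π → ∃[ w ] w ∉ π) {l : Line} {u v : Point} {π π′ : Plane}
    (sp : Special l) (u≢v : u ≢ v) (u≢D : u ≢ D) (v≢D : v ≢ D) (ul : u I l) (vl : v I l)
    (A : Through l u v π) (A′ : Through l u v π′) {x : Point} (xl : x I l) (x∈ : x ∈ π) (x∉ : x ∉ π′) where

    apart : y I l → y ≢ D → ¬ (z I l) → y # z
    apart yl y≢D z∉l Dyz = z∉l (col⇒I (λ e → y≢D (sym e)) sp yl Dyz)

    #⇒off : y # z → z I l → ¬ (y I l)
    #⇒off y#z zl yl = y#z (l , sp , yl , zl)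

    x≢D : x ≢ D
    x≢D refl = x∉ D∈

    dist : y ∈ π → y ∈ π′ → y ≢ D → y I l
    dist {y} y∈ y∈′ y≢D with y I? l
    ... | yes yl = yl
    ... | no y∉l = ⊥-elim (x∉ (plane-⊆ u≢D v≢D y≢D (λ uvy → y∉l (col⇒I u≢v ul vl uvy))
                     (u∈ A) (v∈ A) y∈ (u∈ A′) (v∈ A′) y∈′ x∈))

    -- Project from P = y y′ ∩ s: z goes to z′ and z₁ to z₁′. A point r of x z off s goes to r′,
    -- and z r, z′ r′ meet in a common point of π and π′, which is x.
    module _ {P z z′ z₁ z₁′ : Point} (P∉π : P ∉ π) (P∉π′ : P ∉ π′)
      (z∈ : z ∈ π) (z∉l : ¬ (z I l)) (P#z : P # z) (z′∈ : z′ ∈ π′) (z′≢D : z′ ≢ D) (Pzz′ : Col P z z′)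
      (z₁∈ : z₁ ∈ π) (z₁≢D : z₁ ≢ D) (Dzz₁ : Col D z z₁) (z₁≢z : z₁ ≢ z) (z₁∉l : ¬ (z₁ I l))
      (z₁′∈ : z₁′ ∈ π′) (z₁′∉l : ¬ (z₁′ I l)) (Dz′z₁′ : Col D z′ z₁′) (Pz₁z₁′ : Col P z₁ z₁′) where

      private
        x#z : x # z
        x#z = apart xl x≢D z∉l
        P#z₁ : P # z₁
        P#z₁ = #-sym (#-same z₁≢D Dzz₁ (#-sym P#z))
        ¬xzz₁ : ¬ Col x z z₁
        ¬xzz₁ xzz₁ = line# x#z c122 xzz₁ (λ e → z₁≢z (sym e)) Dzz₁

      module _ {g r r′ : Point} (gl : g I l) (g≢D : g ≢ D) (g∈ : g ∈ π) (g∈′ : g ∈ π′)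
        (xzr : Col x z r) (gz₁r : Col g z₁ r) (P#r : P # r) (Prr′ : Col P r r′) (gz₁′r′ : Col g z₁′ r′) where

        private
          r∈ : r ∈ π
          r∈ = closed g∈ z₁∈ (apart gl g≢D z₁∉l) gz₁r
          g#z₁′ : g # z₁′
          g#z₁′ = apart gl g≢D z₁′∉l
          r′∈ : r′ ∈ π′
          r′∈ = closed g∈′ z₁′∈ g#z₁′ gz₁′r′
          r≢z : r ≢ z
          r≢z refl = apart gl g≢D z∉l (c132 (on-join Dzz₁ c122 z₁≢z (c231 gz₁r)))
          r≢z₁ : r ≢ z₁
          r≢z₁ refl = ¬xzz₁ xzr
          -- Here it matters that `z₁′` lies on `D z′`: this special line meets the ordinary line
          -- `g z₁′` in `z₁′` only, and `r′` = `z₁′` would put `P` into `π`.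
          z′#r′ : z′ # r′
          z′#r′ Dz′r′ with r′ ≟ z₁′
          ... | no r′≢z₁′ = line# g#z₁′ gz₁′r′ c122 r′≢z₁′ (col-D z′≢D Dz′r′ Dz′z₁′)
          ... | yes refl = P∉π (closed r∈ z₁∈ (line# (apart gl g≢D z₁∉l) gz₁r c122 r≢z₁)
                             (on-line P≢z₁′ (c132 Prr′) (c132 Pz₁z₁′) c121))
            where
            P≢z₁′ : P ≢ z₁′
            P≢z₁′ refl = P∉π′ z₁′∈

        meeting-point : ⊥
        meeting-point = case veblen P#z P#r c121 c121 c122 c122 (λ e → r≢z (sym e)) Pzz′ Prr′ (#⇒≢ z′#r′) of
          λ { (X , zrX , z′r′X) → finish zrX z′r′X }
          where
          z#r : z # r
          z#r = line# x#z c122 xzr (λ e → r≢z (sym e))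
          finish : ∀ {X} → Col z r X → Col z′ r′ X → ⊥
          finish {X} zrX z′r′X with X ≟ x
          ... | yes refl = x∉ (closed z′∈ r′∈ z′#r′ z′r′X)
          ... | no X≢x = z∉l (col⇒I X≢x (dist (closed z∈ r∈ z#r zrX) (closed z′∈ r′∈ z′#r′ z′r′X) X≢D) xl
                           (on-line (#⇒≢ x#z) (on-join c122 xzr (λ e → r≢z (sym e)) zrX) c121 c122))
            where
            X≢D : X ≢ D
            X≢D refl = z#r (c312 zrX)

      contradiction : ⊥
      contradiction = case meet-in (#⇒≢ x#z) (#⇒≢ (apart ul u≢D z₁∉l)) x∈ z∈ (u∈ A) z₁∈ of λ { (r , r∈ , xzr , uz₁r) →
                      case meet-in (#⇒≢ x#z) (#⇒≢ (apart vl v≢D z₁∉l)) x∈ z∈ (v∈ A) z₁∈ of λ { (q , q∈ , xzq , vz₁q) →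
                        choose xzr uz₁r xzq vz₁q } }
        where
        try : ∀ {g r} → g I l → g ≢ D → g ∈ π → g ∈ π′ → Col x z r → Col g z₁ r → P # r → ⊥
        try gl g≢D g∈ g∈′ xzr gz₁r P#r =
          case veblen P#z₁ (apart gl g≢D z₁∉l) c122 c122 c121 gz₁r (#⇒≢ P#r) Pz₁z₁′ c121 (λ { refl → z₁′∉l gl }) of
            λ { (r′ , Prr′ , z₁′gr′) → meeting-point gl g≢D g∈ g∈′ xzr gz₁r P#r Prr′ (c213 z₁′gr′) }
        -- Projection from `P` needs a point off `D P`. If `r` and `q` were both on it, they would
        -- coincide, as they lie on the ordinary line `x z`; being on `u z₁` and `v z₁`, they would
        -- then equal `z₁`.
        choose : ∀ {r q} → Col x z r → Col u z₁ r → Col x z q → Col v z₁ q → ⊥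
        choose {r} {q} xzr uz₁r xzq vz₁q with #? P r | #? P q | r ≟ q
        ... | inj₁ P#r | _ | _ = try ul u≢D (u∈ A) (u∈ A′) xzr uz₁r P#r
        ... | _ | inj₁ P#q | _ = try vl v≢D (v∈ A) (v∈ A′) xzq vz₁q P#q
        ... | inj₂ DPr | inj₂ DPq | no r≢q = line# x#z xzr xzq r≢q (col-D (#⇒≢Dˡ P#z) DPr DPq)
        ... | _ | _ | yes refl = ¬xzz₁ (subst (Col x z) (cross (λ c → z₁∉l (col⇒I u≢v ul vl (c231 c))) (c213 uz₁r) (c213 vz₁q)) xzr)

    module _ {y : Point} (y∈ : y ∈ π) (y∉l : ¬ (y I l)) (y≢D : y ≢ D) where

      private
        u#y : u # y
        u#y = apart ul u≢D y∉l
        v#y : v # y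
        v#y = apart vl v≢D y∉l

      absurd-z₁ : ∀ {y′ P z z′ z₁} → y′ ∈ π′ → y′ # u → y # y′ → Col y y′ P → P ∉ π → P ∉ π′ →
                  z ∈ π → z # u → z # y → z # P → Col u y z → Col z P z′ → Col u y′ z′ →
                  Col v y z₁ → Col D z z₁ → z₁ ≢ D → ⊥
      absurd-z₁ {y′} {P} {z} {z′} {z₁} y′∈ y′#u y#y′ yy′P P∉π P∉π′ z∈ z#u z#y z#P uyz zPz′ uy′z′ vyz₁ Dzz₁ z₁≢D =
        case joined y y′ of λ { (k , yk , y′k) →
        case plane-through y≢D (#⇒≢Dʳ y#y′) u≢D (ncg (u∈ A) u#y) of λ { (α , yα , y′α , uα) →
        case plane-through y≢D (#⇒≢Dʳ y#y′) v≢D (ncg (v∈ A) v#y) of λ { (β , yβ , y′β , vβ) →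
        case Parallel.parallel pick outside sp ul vl z∉l y#y′ yk y′k yα y′α uα yβ y′β vβ
               (λ uk → ncg (u∈ A) u#y (k , yk , y′k , uk)) (λ vk → ncg (v∈ A) v#y (k , yk , y′k , vk))
               u#y v#y (#-sym z#u) v#z₁ (#⇒≢ z#y) z₁≢y uyz vyz₁ Dzz₁
               (col⇒I (#⇒≢ y#y′) yk y′k yy′P) (#-sym y′#u) z≢z′ z′≢u (#⇒≢Dˡ z′#u) uy′z′ (c213 zPz′) of λ { (z₁′ , vy′z₁′ , Dz′z₁′ , Pz₁z₁′) →
        contradiction P∉π P∉π′ z∈ z∉l (#-sym z#P) z′∈ (#⇒≢Dˡ z′#u) (c213 zPz′) z₁∈ z₁≢D Dzz₁ z₁≢z z₁∉l
          (closed (v∈ A′) y′∈ v#y′ vy′z₁′) (z₁′-off vy′z₁′ Pz₁z₁′) Dz′z₁′ Pz₁z₁′ } } } }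
        where
        z∉l : ¬ (z I l)
        z∉l = #⇒off z#u ul
        y′∉l : ¬ (y′ I l)
        y′∉l = #⇒off y′#u ul
        v#y′ : v # y′
        v#y′ = apart vl v≢D y′∉l
        ncg : ∀ {g} → g ∈ π → g # y → ¬ Col y y′ g
        ncg g∈ g#y yy′g = y′∉l (dist (closed g∈ y∈ g#y (c312 yy′g)) y′∈ (#⇒≢Dʳ y#y′))
        z′∈ : z′ ∈ π′
        z′∈ = closed (u∈ A′) y′∈ (#-sym y′#u) uy′z′
        z≢z′ : z ≢ z′
        z≢z′ refl = z∉l (dist z∈ z′∈ (#⇒≢Dˡ z#u))
        z′≢u : z′ ≢ u
        z′≢u refl = P∉π (closed z∈ (u∈ A) z#u (c132 zPz′))
        z′#u : z′ # u
        z′#u = line# (#-sym y′#u) uy′z′ c121 z′≢u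
        z₁∈ : z₁ ∈ π
        z₁∈ = closed (v∈ A) y∈ v#y vyz₁
        z₁≢z : z₁ ≢ z
        z₁≢z refl = y∉l (col⇒I u≢v ul vl (on-line (#⇒≢ z#y) (c321 uyz) (c321 vyz₁) c122))
        z₁∉l : ¬ (z₁ I l)
        z₁∉l z₁l = z∉l (col⇒I (λ e → z₁≢D (sym e)) sp z₁l (c132 Dzz₁))
        v#z₁ : v # z₁
        v#z₁ = apart vl v≢D z₁∉l
        z₁≢y : z₁ ≢ y
        z₁≢y refl = z#y Dzz₁
        z₁′-off : ∀ {z₁′} → Col v y′ z₁′ → Col P z₁ z₁′ → ¬ (z₁′ I l)
        z₁′-off {z₁′} vy′z₁′ Pz₁z₁′ z₁′l with z₁′ ≟ v
        ... | yes refl = P∉π (closed z₁∈ (v∈ A) (#-sym v#z₁) (c231 Pz₁z₁′))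
        ... | no z₁′≢v = y′∉l (col⇒I z₁′≢v z₁′l vl (c312 vy′z₁′))

      -- The figure of `Parallel` is set up across the two planes: `y` is in `π` and `y′` in `π′`,
      -- `P` is a further point of `y y′` and so in neither, and `z′` is the projection of `z` from
      -- `P`.
      absurd : ⊥
      absurd =
        case pick (apart ul u≢D (w∉l A′)) u≢D y≢D y≢D of λ { (y′ , uwy′ , y′#u , y′#y , _) →
        case pick (#-sym y′#y) u≢D y≢D (#⇒≢Dˡ y′#y) of λ { (P , yy′P , P#u , P#y , P#y′) →
        case pick u#y u≢D y≢D (#⇒≢Dˡ P#u) of λ { (z , uyz , z#u , z#y , z#P) →
        case veblen u#y (#-sym y′#y) c122 c121 uyz yy′P (#⇒≢ z#P) c121 c122 (λ e → #⇒≢ y′#u (sym e)) of λ { (z′ , zPz′ , uy′z′) →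
        case cut v#y (#⇒≢Dˡ z#u) of λ { (z₁ , vyz₁ , Dzz₁ , z₁≢D) →
          let y′∈ : y′ ∈ π′
              y′∈ = closed (u∈ A′) (w∈ A′) (apart ul u≢D (w∉l A′)) uwy′
              y′∉l : ¬ (y′ I l)
              y′∉l = #⇒off y′#u ul
          in absurd-z₁ y′∈ y′#u (#-sym y′#y) yy′P
               (λ P∈ → y′∉l (dist (closed y∈ P∈ (#-sym P#y) (c132 yy′P)) y′∈ (#⇒≢Dˡ y′#y)))
               (λ P∈ → y∉l (dist y∈ (closed y′∈ P∈ (#-sym P#y′) (c231 yy′P)) y≢D))
               (closed (u∈ A) y∈ u#y uyz) z#u z#y z#P uyz zPz′ uy′z′ vyz₁ Dzz₁ z₁≢D } } } } }

  share-special : Pick → (∀ π → ∃[ w ] w ∉ π) → Special l → u ≢ v → u ≢ D → v ≢ D → u I l → v I l →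
                  Through l u v π → Through l u v π′ → x I l → x ∈ π → x ∈ π′
  share-special {π′ = π′} {x = x} pick outside sp u≢v u≢D v≢D ul vl A A′ xl x∈ with em {P = x ∈ π′}
  ... | yes x∈′ = x∈′
  ... | no x∉ = ⊥-elim (Share.absurd pick outside sp u≢v u≢D v≢D ul vl A A′ xl x∈ x∉ (w∈ A) (w∉l A) (w≢D A))

  -- Harmonic configurations

  open HarmonicConfiguration
  open Quadrangle

  meets-axis : ∀ {d} → d I l → ¬ (a I l) → Col d a x → x I l → x ≡ d
  meets-axis {d = d} dl a∉l dax xl with _ ≟ d
  ... | yes e = e
  ... | no x≢d = ⊥-elim (a∉l (col⇒I x≢d xl dl (c312 dax)))

  unique-meet : ∀ {d e} → d I l → e I l → d ≢ e → ¬ (a I l) → ¬ (b I l) →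
                Col d a x → Col d a y → Col e b x → Col e b y → x ≡ y
  unique-meet {a = a} {b} {x} {y} dl el d≢e a∉l b∉l dax day ebx eby with x ≟ y
  ... | yes e = e
  ... | no x≢y = ⊥-elim (a∉l (col⇒I d≢e dl el (on-line x≢y
          (on-line (λ { refl → a∉l dl }) dax day c121) (on-line (λ { refl → b∉l el }) ebx eby c121)
          (on-line (λ { refl → a∉l dl }) dax day c122))))

  -- All further nondegeneracy follows from the five collinearities, so only these have to be
  -- checked when a configuration is constructed or transported.
  configure : ∀ {d e f a₁ a₂ a₃ a₄} → Distinct₃ d e f → d I l → e I l → f I l → ¬ (a₁ I l) → ¬ (a₄ I l) → a₁ ≢ a₄ →
              Col d a₁ a₂ → Col d a₄ a₃ → Col e a₄ a₂ → Col f a₄ a₁ → Col f a₃ a₂ →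
              HarmonicConfiguration l d e f a₁ a₂ a₃ a₄
  configure {l} {d} {e} {f} {a₁} {a₂} {a₃} {a₄} D₃@(d≢e , d≢f , e≢f) dl el fl ¬a₁l ¬a₄l a₁≢₄ c₁ c₂ c₃ c₄ c₅ = record
    { distinct = D₃ ; d∈l = dl ; e∈l = el ; f∈l = fl ; a₁∉l = ¬a₁l ; a₂∉l = ¬a₂l ; a₃∉l = ¬a₃l ; a₄∉l = ¬a₄l
    ; quadrangle = record
      { a₁≢a₂ = λ { refl → a₁≢₄ (sym (joint fl el (≢-sym e≢f) ¬a₄l c₄ c₃)) }
      ; a₁≢a₃ = λ { refl → a₁≢₄ (sym (joint dl fl d≢f ¬a₄l c₂ c₄)) }
      ; a₁≢a₄ = a₁≢₄ ; a₂≢a₃ = a₂≢₃ ; a₂≢a₄ = a₂≢₄ ; a₃≢a₄ = a₃≢₄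
      ; ¬a₁a₂a₃ = λ c → a₂≢₃ (joint dl fl d≢f ¬a₂l (on-line a₁≢₂ (c231 c₁) c122 c) (c132 c₅))
      ; ¬a₁a₂a₄ = λ c → a₁≢₄ (joint dl fl d≢f ¬a₁l (on-line a₁≢₂ (c231 c₁) c121 c) (c132 c₄))
      ; ¬a₁a₃a₄ = λ c → a₁≢₄ (sym (joint dl fl d≢f ¬a₄l (on-line a₃≢₄ (c321 c₂) c122 (c231 c)) c₄))
      ; ¬a₂a₃a₄ = λ c → a₂≢₄ (sym (joint dl el d≢e ¬a₄l (on-line a₃≢₄ (c321 c₂) c122 (c231 c)) c₃)) }
    ; da₁a₂ = c₁ ; da₄a₃ = c₂ ; ea₄a₂ = c₃ ; fa₄a₁ = c₄ ; fa₃a₂ = c₅ }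
    where
    joint : ∀ {g h x y} → g I l → h I l → g ≢ h → ¬ (x I l) → Col g x y → Col h x y → x ≡ y
    joint gl hl g≢h x∉l gxy hxy = unique-meet gl hl g≢h x∉l x∉l c122 gxy c122 hxy
    ¬a₂l : ¬ (a₂ I l)
    ¬a₂l a₂l = d≢e (trans (sym (meets-axis dl ¬a₁l c₁ a₂l)) (meets-axis el ¬a₄l c₃ a₂l))
    ¬a₃l : ¬ (a₃ I l)
    ¬a₃l a₃l = d≢f (trans (sym (meets-axis dl ¬a₄l c₂ a₃l)) (meets-axis fl ¬a₂l (c132 c₅) a₃l))
    a₁≢₂ : a₁ ≢ a₂
    a₁≢₂ refl = a₁≢₄ (sym (joint fl el (≢-sym e≢f) ¬a₄l c₄ c₃))
    a₂≢₄ : a₂ ≢ a₄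
    a₂≢₄ refl = a₁≢₄ (joint dl fl d≢f ¬a₁l c₁ (c132 c₄))
    a₂≢₃ : a₂ ≢ a₃
    a₂≢₃ refl = a₂≢₄ (sym (joint dl el d≢e ¬a₄l c₂ c₃))
    a₃≢₄ : a₃ ≢ a₄
    a₃≢₄ refl = a₂≢₄ (sym (joint fl el (≢-sym e≢f) ¬a₄l c₅ c₃))

  -- Reduces the case `f` = `D`, where `a₁ a₄` always passes through `D`, to `d` = `D`.
  swap-conf : ∀ {d e f a₁ a₂ a₃ a₄} → HarmonicConfiguration l d e f a₁ a₂ a₃ a₄ → HarmonicConfiguration l f e d a₃ a₂ a₁ a₄
  swap-conf H with d≢e , d≢f , e≢f ← distinct H =
    configure (≢-sym e≢f , ≢-sym d≢f , ≢-sym d≢e) (f∈l H) (e∈l H) (d∈l H) (a₃∉l H) (a₄∉l H) (a₃≢a₄ (quadrangle H))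
      (fa₃a₂ H) (fa₄a₁ H) (ea₄a₂ H) (da₄a₃ H) (da₁a₂ H)

  swap-conjugate : ∀ {d e f} → HarmonicConjugateExists l f e d → HarmonicConjugateExists l d e f
  swap-conjugate (h , record { configuration = (a₁ , a₂ , a₃ , a₄ , H) ; conjugate = conj }) = h , record
    { configuration = a₃ , a₂ , a₁ , a₄ , swap-conf H
    ; conjugate = λ H′ → let (m , a₃m , a₁m , mt) = conj (swap-conf H′) in m , a₁m , a₃m , mt }

  meet-axis : ∀ {h} → ¬ (a I l) → h I l → Col h a b → ∃[ m ] (a I m × b I m × MeetIn m l h)
  meet-axis {h = h} a∉l hl (m , hm , am , bm) = m , am , bm , (hm , hl) , λ { {y} (ym , yl) → same ym yl }
    where
    same : ∀ {y} → y I m → y I _ → h ≡ y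
    same {y} ym yl with h ≟ y
    ... | yes e = e
    ... | no h≢y with refl ← uniq h≢y hm ym hl yl = ⊥-elim (a∉l am)

  build : ∀ {d e f a₁} → Distinct₃ d e f → d I l → e I l → f I l → d ∈ π → e ∈ π → f ∈ π →
          a₁ ∈ π → ¬ (a₁ I l) → a₁ # f →
          ∃[ a₂ ] ∃[ a₃ ] ∃[ a₄ ] (HarmonicConfiguration l d e f a₁ a₂ a₃ a₄ × a₂ ∈ π × a₃ ∈ π × a₄ ∈ π × a₁ # a₄)
  build {d = d} {e} {f} {a₁} D₃@(d≢e , d≢f , e≢f) dl el fl d∈ e∈ f∈ a₁∈ ¬a₁l a₁#f =
    case third a₁#f of λ { (a₄ , a₁fa₄ , a₄#a₁ , a₄#f) →
    let ¬a₄l : ¬ (a₄ I _)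
        ¬a₄l a₄l = ¬a₁l (col⇒I (#⇒≢ a₄#f) a₄l fl (c321 a₁fa₄))
        a₄∈ = closed a₁∈ f∈ a₁#f a₁fa₄ in
    case meet-in (λ { refl → ¬a₁l dl }) (λ { refl → ¬a₄l el }) d∈ a₁∈ e∈ a₄∈ of λ { (a₂ , a₂∈ , da₁a₂ , ea₄a₂) →
    let f≢a₂ : f ≢ a₂
        f≢a₂ = λ { refl → d≢f (sym (meets-axis dl ¬a₁l da₁a₂ fl)) } in
    case meet-in (λ { refl → ¬a₄l dl }) f≢a₂ d∈ a₄∈ f∈ a₂∈ of λ { (a₃ , a₃∈ , da₄a₃ , fa₂a₃) →
    a₂ , a₃ , a₄ , configure D₃ dl el fl ¬a₁l ¬a₄l (≢-sym (#⇒≢ a₄#a₁)) da₁a₂ da₄a₃ ea₄a₂ (c231 a₁fa₄) (c132 fa₂a₃)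
    , a₂∈ , a₃∈ , a₄∈ , #-sym a₄#a₁ } } }

  on-special : x ≢ D → ∃[ t ] (Col D x t × t ≢ D × t ≢ x)
  on-special {x} x≢D with l , Dl , xl ← joined D x with A3 l
  ... | t₁ , t₂ , t₃ , (t₁≢t₂ , t₁≢t₃ , t₂≢t₃) , t₁l , t₂l , t₃l = choose
    where
    ok : ∀ {t} → t I l → t ≢ D → t ≢ x → ∃[ t ] (Col D x t × t ≢ D × t ≢ x)
    ok tl t≢D t≢x = _ , (l , Dl , xl , tl) , t≢D , t≢x
    choose : ∃[ t ] (Col D x t × t ≢ D × t ≢ x)
    choose with t₁ ≟ D | t₁ ≟ x | t₂ ≟ D | t₂ ≟ x
    ... | no p | no q | _ | _ = ok t₁l p q
    ... | _ | _ | no p | no q = ok t₂l p q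
    ... | yes refl | _ | yes refl | _ = ⊥-elim (t₁≢t₂ refl)
    ... | yes refl | _ | _ | yes refl = ok t₃l (≢-sym t₁≢t₃) (≢-sym t₂≢t₃)
    ... | _ | yes refl | yes refl | _ = ok t₃l (≢-sym t₂≢t₃) (≢-sym t₁≢t₃)
    ... | _ | yes refl | _ | yes refl = ⊥-elim (t₁≢t₂ refl)

  off-line : ∀ l → ∃[ x ] ¬ (x I l)
  off-line l with a₁ , a₂ , a₃ , _ , Q ← A2 with a₁ I? l | a₂ I? l | a₃ I? l
  ... | no n | _ | _ = a₁ , n
  ... | _ | no n | _ = a₂ , n
  ... | _ | _ | no n = a₃ , n
  ... | yes i₁ | yes i₂ | yes i₃ = ⊥-elim (¬a₁a₂a₃ Q (l , i₁ , i₂ , i₃))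

  -- `build` takes `a₄` on the join with `f`, which therefore has to be ordinary. For ordinary `l`
  -- the special line of `g` supplies the point, as it meets `l` only in `g`.
  first-point : ∀ {f g} → f I l → g I l → f ≢ g → f ≢ D → g ≢ D → ∃[ a ] (¬ (a I l) × a # f)
  first-point {l} {f} {g} fl gl f≢g f≢D g≢D with D I? l
  ... | yes sp with a , a∉l ← off-line l = a , a∉l , λ Daf → a∉l (col⇒I (≢-sym f≢D) sp fl (c132 Daf))
  ... | no ord with t , Dgt , t≢D , t≢g ← on-special g≢D
      = t , (λ tl → ord (col⇒I t≢g tl gl (c321 Dgt))) , #-same t≢D Dgt (ord⇒# ord gl fl (≢-sym f≢g))

  -- Comparing configurations in different planes

  record Placed (l : Line) (u v d e f a₁ a₂ a₃ a₄ : Point) : Set (lsuc (ℓp ⊔ ℓl ⊔ ℓi)) where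
    field
      {ρ} : Plane
      thru : Through l u v ρ
      conf : HarmonicConfiguration l d e f a₁ a₂ a₃ a₄
      d∈ : d ∈ ρ
      e∈ : e ∈ ρ
      f∈ : f ∈ ρ
      a₁∈ : a₁ ∈ ρ
      a₂∈ : a₂ ∈ ρ
      a₃∈ : a₃ ∈ ρ
      a₄∈ : a₄ ∈ ρ

  open Placed

  -- A configuration whose line a₁ a₄ is ordinary, with the same conjugate as the one that has a₁ = x and a₃ = y.
  record Standard (l : Line) (u v d e f x y : Point) : Set (lsuc (ℓp ⊔ ℓl ⊔ ℓi)) where
    field
      {b₁ b₂ b₃ b₄ h} : Point
      at : Placed l u v d e f b₁ b₂ b₃ b₄
      b₁#b₄ : b₁ # b₄
      h∈l : h I l
      h∈ : h ∈ ρ at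
      hxy : Col h x y
      hb₁b₃ : Col h b₁ b₃

  open Standard

  module Conjugation (pick : Pick) (outside : ∀ π → ∃[ w ] w ∉ π) {l : Line} {u v : Point}
    (u≢v : u ≢ v) (u≢D : u ≢ D) (v≢D : v ≢ D) (ul : u I l) (vl : v I l)
    (share : ∀ {π π′ x} → Through l u v π → Through l u v π′ → x I l → x ∈ π → x ∈ π′)
    {d e f : Point} where

    Conf : Point → Point → Point → Point → Set (lsuc (ℓp ⊔ ℓl ⊔ ℓi))
    Conf = Placed l u v d e f

    move-conf : ∀ {a₁ a₂ a₃ a₄ b₁ b₄} (C : Conf a₁ a₂ a₃ a₄) → Through l u v π′ → (φ : Iso l (ρ C) π′) →
                Iso.rel φ a₁ b₁ → Iso.rel φ a₄ b₄ → b₁ ∈ π′ → b₄ ∈ π′ →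
                ∃[ b₂ ] ∃[ b₃ ] (Conf b₁ b₂ b₃ b₄ × (∀ {h} → h I l → h ∈ ρ C → Col h a₁ a₃ → Col h b₁ b₃))
    move-conf {π′ = π′} {a₁} {a₂} {a₃} {a₄} {b₁} {b₄} C B φ φ₁ φ₄ b₁∈ b₄∈ = finish (Iso.img φ (a₂∈ C)) (Iso.img φ (a₃∈ C))
      where
      H = conf C
      Q = quadrangle H
      finish : ∃[ b₂ ] (b₂ ∈ π′ × Iso.rel φ a₂ b₂) → ∃[ b₃ ] (b₃ ∈ π′ × Iso.rel φ a₃ b₃) →
               ∃[ b₂ ] ∃[ b₃ ] (Conf b₁ b₂ b₃ b₄ × (∀ {h} → h I l → h ∈ ρ C → Col h a₁ a₃ → Col h b₁ b₃))
      finish (b₂ , b₂∈ , φ₂) (b₃ , b₃∈ , φ₃) = b₂ , b₃ , record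
        { thru = B
        ; conf = configure (distinct H) (d∈l H) (e∈l H) (f∈l H) (Iso.offl φ φ₁ (a₁∉l H)) (Iso.offl φ φ₄ (a₄∉l H))
            (Iso.inj φ φ₁ φ₄ (a₁≢a₄ Q)) (Iso.pres φ φ₁ φ₂ (a₁≢a₂ Q) (d∈l H) (d∈ C) (da₁a₂ H))
            (Iso.pres φ φ₄ φ₃ (≢-sym (a₃≢a₄ Q)) (d∈l H) (d∈ C) (da₄a₃ H))
            (Iso.pres φ φ₄ φ₂ (≢-sym (a₂≢a₄ Q)) (e∈l H) (e∈ C) (ea₄a₂ H))
            (Iso.pres φ φ₄ φ₁ (≢-sym (a₁≢a₄ Q)) (f∈l H) (f∈ C) (fa₄a₁ H))
            (Iso.pres φ φ₃ φ₂ (≢-sym (a₂≢a₃ Q)) (f∈l H) (f∈ C) (fa₃a₂ H))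
        ; d∈ = share (thru C) B (d∈l H) (d∈ C) ; e∈ = share (thru C) B (e∈l H) (e∈ C) ; f∈ = share (thru C) B (f∈l H) (f∈ C)
        ; a₁∈ = b₁∈ ; a₂∈ = b₂∈ ; a₃∈ = b₃∈ ; a₄∈ = b₄∈ } , λ hl h∈ c → Iso.pres φ φ₁ φ₃ (a₁≢a₃ Q) hl h∈ c

    -- `a₂` is where `d a₁` meets `e a₄`, and `a₃` is where `d a₄` meets `f a₂`. Hence an
    -- isomorphism only has to match `a₁` and `a₄`.
    determined : ∀ {a₁ a₂ a₃ a₄ b₂ b₃} → HarmonicConfiguration l d e f a₁ a₂ a₃ a₄ →
                 HarmonicConfiguration l d e f a₁ b₂ b₃ a₄ → a₃ ≡ b₃
    determined {a₁} {a₂} {a₃} {a₄} {b₂} {b₃} H K with d≢e , d≢f , e≢f ← distinct H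
      = unique-meet (d∈l H) (f∈l H) d≢f (a₄∉l H) (a₂∉l H) (da₄a₃ H) (da₄a₃ K) (c132 (fa₃a₂ H))
          (subst (λ b → Col f b b₃) (sym a₂≡b₂) (c132 (fa₃a₂ K)))
      where
      a₂≡b₂ : a₂ ≡ b₂
      a₂≡b₂ = unique-meet (d∈l H) (e∈l H) (proj₁ (distinct H)) (a₁∉l H) (a₄∉l H) (da₁a₂ H) (da₁a₂ K) (ea₄a₂ H) (ea₄a₂ K)

    agree : ∀ {a₁ a₂ a₃ a₄ b₁ b₂ b₃ b₄ h} (C : Conf a₁ a₂ a₃ a₄) (K : Conf b₁ b₂ b₃ b₄) → a₁ # a₄ → b₁ # b₄ →
            h I l → h ∈ ρ C → Col h a₁ a₃ → Col h b₁ b₃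
    agree {b₁ = b₁} {h = h} C K a₁#a₄ b₁#b₄ hl h∈ ha =
      case Axis.iso₂ pick outside u≢v u≢D v≢D ul vl share (thru C) (thru K) (a₁∈ C) (a₄∈ C) (a₁∉l H) (a₄∉l H)
             (a₁∈ K) (a₄∈ K) (a₁∉l (conf K)) (a₄∉l (conf K)) (f∈l H) (f∈ C) (c132 (fa₄a₁ H)) (c132 (fa₄a₁ (conf K))) a₁#a₄ b₁#b₄
      of λ { (φ , φ₁ , φ₄) → case move-conf C (thru K) φ φ₁ φ₄ (a₁∈ K) (a₄∈ K) of λ { (_ , _ , B , tr) →
        subst (Col h b₁) (determined (conf B) (conf K)) (tr hl h∈ ha) } }
      where H = conf C

    module _ (d∈ₚ : ∀ {π} → Through l u v π → d ∈ π) (e∈ₚ : ∀ {π} → Through l u v π → e ∈ π)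
      (f∈ₚ : ∀ {π} → Through l u v π → f ∈ π) (D₃ : Distinct₃ d e f) (dl : d I l) (el : e I l) (fl : f I l)
      (standard : ∀ {a₁ a₂ a₃ a₄} → HarmonicConfiguration l d e f a₁ a₂ a₃ a₄ → Standard l u v d e f a₁ a₃)
      {c : Point} (c∉l : ¬ (c I l)) (c#f : c # f) where

      exists : HarmonicConjugateExists l d e f
      exists =
        case plane-through u≢D v≢D (#⇒≢Dˡ c#f) (λ uvc → c∉l (col⇒I u≢v ul vl uvc)) of λ { (π , u∈π , v∈π , c∈π) →
        let A : Through l u v π
            A = record { u∈ = u∈π ; v∈ = v∈π ; w∈ = c∈π ; w∉l = c∉l ; w≢D = #⇒≢Dˡ c#f } in
        case build D₃ dl el fl (d∈ₚ A) (e∈ₚ A) (f∈ₚ A) c∈π c∉l c#f of λ { (c₂ , c₃ , c₄ , H , c₂∈ , c₃∈ , c₄∈ , c#c₄) →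
        let K : Conf c c₂ c₃ c₄
            K = record { thru = A ; conf = H ; d∈ = d∈ₚ A ; e∈ = e∈ₚ A ; f∈ = f∈ₚ A ; a₁∈ = c∈π ; a₂∈ = c₂∈ ; a₃∈ = c₃∈ ; a₄∈ = c₄∈ } in
        finish K c#c₄ (h∈l (standard H)) (hxy (standard H)) } }
        where
        finish : ∀ {c₂ c₃ c₄ h} (K : Conf c c₂ c₃ c₄) → c # c₄ → h I l → Col h c c₃ → HarmonicConjugateExists l d e f
        finish {c₂} {c₃} {c₄} {h} K c#c₄ hl hc = h , record
          { configuration = c , c₂ , c₃ , c₄ , conf K
          ; conjugate = λ {a₁} {a₂} {a₃} H → let S = standard H in
              meet-axis (a₁∉l H) hl (subst (λ x → Col x a₁ a₃)
                (same (h∈l S) (agree (at S) K (b₁#b₄ S) c#c₄ (h∈l S) (h∈ S) (hb₁b₃ S))) (hxy S)) }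
          where
          same : ∀ {h′} → h′ I l → Col h′ c c₃ → h′ ≡ h
          same {h′} h′l h′c with h′ ≟ h
          ... | yes e = e
          ... | no h′≢h = ⊥-elim (c∉l (col⇒I h′≢h h′l hl (on-line (a₁≢a₃ (quadrangle (conf K))) (c231 h′c) (c231 hc) c121)))

  -- The number of special lines: t is separated when its points lie on distinct special lines.
  Separated : ∀ {n} → (Fin n → Point) → Set (ℓl ⊔ ℓi)
  Separated t = ∀ {i j} → i ≢ j → t i # t j

  -- At most one of the separated points is on the special line of `x`. Three applications to four
  -- points leave one.
  thin : ∀ {n} (t : Fin (suc n) → Point) → Separated t → x ≢ D → ∃[ j ] (∀ i → t (punchIn j i) # x)
  thin {x} t sep x≢D with any? (λ i → col? D (t i) x)
  ... | yes (j , Dtx) = j , λ i Dt′x → sep (λ e → punchInᵢ≢i j i e) (col-D x≢D (c132 Dt′x) (c132 Dtx))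
  ... | no none = zero , λ i Dtx → none (_ , Dtx)

  four⇒pick : (t : Fin 4 → Point) → Separated t → Pick
  four⇒pick t sep {a} {b} a#b x≢D y≢D z≢D =
    case thin s s-sep x≢D of λ { (j , s#x) →
    case thin (λ i → s (punchIn j i)) (λ n → s-sep (λ e → n (punchIn-injective j _ _ e))) y≢D of λ { (k , s#y) →
    case thin (λ i → s (punchIn j (punchIn k i))) (λ n → s-sep (λ e → n (punchIn-injective k _ _ (punchIn-injective j _ _ e)))) z≢D
    of λ { (m , s#z) →
      _ , proj₁ (proj₂ (cuts _)) , s#x (punchIn k (punchIn m zero)) , s#y (punchIn m zero) , s#z zero } } }
    where
    t≢D : ∀ i → t i ≢ D
    t≢D zero = #⇒≢Dˡ (sep {zero} {suc zero} λ ())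
    t≢D (suc i) = #⇒≢Dˡ (sep {suc i} {zero} λ ())
    cuts : ∀ i → ∃[ s ] (Col a b s × Col D (t i) s × s ≢ D)
    cuts i = cut a#b (t≢D i)
    s : Fin 4 → Point
    s i = proj₁ (cuts i)
    s-sep : Separated s
    s-sep {i} {j} i≢j = same i (#-sym (same j (#-sym (sep i≢j))))
      where
      same : ∀ i {x} → t i # x → s i # x
      same i = #-same (proj₂ (proj₂ (proj₂ (cuts i)))) (proj₁ (proj₂ (proj₂ (cuts i))))

  separate : w₁ # w₂ → w₁ # w₃ → w₁ # w₄ → w₂ # w₃ → w₂ # w₄ → w₃ # w₄ → ∃ (Separated {4})
  separate {w₁} {w₂} {w₃} {w₄} s₁₂ s₁₃ s₁₄ s₂₃ s₂₄ s₃₄ = pts , sep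
    where
    pts : Fin 4 → Point
    pts zero = w₁
    pts (suc zero) = w₂
    pts (suc (suc zero)) = w₃
    pts (suc (suc (suc zero))) = w₄
    below : ∀ {i j} → i < j → pts i # pts j
    below {zero} {suc zero} _ = s₁₂
    below {zero} {suc (suc zero)} _ = s₁₃
    below {zero} {suc (suc (suc zero))} _ = s₁₄
    below {suc zero} {suc (suc zero)} _ = s₂₃
    below {suc zero} {suc (suc (suc zero))} _ = s₂₄
    below {suc (suc zero)} {suc (suc (suc zero))} _ = s₃₄
    below {suc zero} {suc zero} (s≤s ())
    below {suc (suc zero)} {suc zero} (s≤s ())
    below {suc (suc zero)} {suc (suc zero)} (s≤s (s≤s ()))
    below {suc (suc (suc zero))} {suc zero} (s≤s ())
    below {suc (suc (suc zero))} {suc (suc zero)} (s≤s (s≤s ()))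
    below {suc (suc (suc zero))} {suc (suc (suc zero))} (s≤s (s≤s (s≤s ())))
    sep : Separated pts
    sep {i} {j} i≢j with <-cmp i j
    ... | tri< i<j _ _ = below i<j
    ... | tri≈ _ e _ = ⊥-elim (i≢j e)
    ... | tri> _ _ j<i = #-sym (below j<i)

  -- If a plane contained every point, `meet-in` would make any two lines meet.
  nontrivial⇒outside : Nontrivial → ∀ π → ∃[ w ] w ∉ π
  nontrivial⇒outside nt π with em {P = ∃[ w ] w ∉ π}
  ... | yes out = out
  ... | no none = ⊥-elim (nt record { join = A1 ; meet = meet ; quadrangle = A2 })
    where
    all : ∀ x → x ∈ π
    all x with em {P = x ∈ π}
    ... | yes x∈ = x∈
    ... | no x∉ = ⊥-elim (none (x , x∉))
    meet : l ≢ m → ∃! _≡_ λ x → x I l × x I m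
    meet {l} {m} l≢m
      with x , y , _ , (x≢y , _) , xl , yl , _ ← A3 l | z , w , _ , (z≢w , _) , zm , wm , _ ← A3 m
      with o , _ , xyo , zwo ← meet-in x≢y z≢w (all x) (all y) (all z) (all w)
      with ol ← col⇒I x≢y xl yl xyo | om ← col⇒I z≢w zm wm zwo
      = o , (ol , om) , λ { {y} (yl , ym) → same ol om yl ym }
      where
      same : ∀ {o y} → o I l → o I m → y I l → y I m → o ≡ y
      same {o} {y} ol om yl ym with o ≟ y
      ... | yes e = e
      ... | no o≢y = ⊥-elim (l≢m (uniq o≢y ol yl om ym))

  -- Conjugates on an ordinary line

  spread : ∀ {g} → g ≢ x → Col D g x → Col g x y → Col D g y
  spread g≢x Dgx gxy = on-join c122 Dgx g≢x gxy

  module OrdinaryLine {l : Line} (ord : Ordinary l) {d e f : Point} (D₃ : Distinct₃ d e f) (dl : d I l) (el : e I l) (fl : f I l) where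

    private
      d≢f : d ≢ f
      d≢f = proj₁ (proj₂ D₃)
      d#e : d # e
      d#e = ord⇒# ord dl el (proj₁ D₃)
      d#f : d # f
      d#f = ord⇒# ord dl fl d≢f
      e#f : e # f
      e#f = ord⇒# ord el fl (proj₂ (proj₂ D₃))
      d≢D : d ≢ D
      d≢D = #⇒≢Dˡ d#f
      f≢D : f ≢ D
      f≢D = #⇒≢Dʳ d#f

    on-l : Through l d f π → x I l → x ∈ π
    on-l A xl = closed (u∈ A) (v∈ A) d#f (l , dl , fl , xl)

    through : x ≢ D → ¬ (x I l) → ∃[ π ] (Through l d f π × x ∈ π)
    through x≢D x∉l = case plane-through d≢D f≢D x≢D (λ dfx → x∉l (col⇒I d≢f dl fl dfx)) of λ { (π , d∈π , f∈π , x∈π) →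
      π , record { u∈ = d∈π ; v∈ = f∈π ; w∈ = x∈π ; w∉l = x∉l ; w≢D = x≢D } , x∈π }

    module _ {a₁ a₂ a₃ a₄ : Point} (H : HarmonicConfiguration l d e f a₁ a₂ a₃ a₄) where

      private
        Q = quadrangle H
        l≢ : ∀ {g x} → g I l → ¬ (x I l) → g ≢ x
        l≢ gl x∉l refl = x∉l gl
        D∈′ : x ≡ D → x ∈ π
        D∈′ refl = D∈

      -- `a₂` and `a₃` each lie on two lines joining points already in `π`. If both lines are
      -- special they are different, and the point is `D`, which every plane contains.
      coplanar₁ : Through l d f π → a₁ ∈ π → f # a₁ → a₂ ∈ π × a₃ ∈ π × a₄ ∈ π
      coplanar₁ {π} A a₁∈ f#a₁ = a₂∈π , a₃∈π , a₄∈π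
        where
        a₄∈π : a₄ ∈ π
        a₄∈π = closed (v∈ A) a₁∈ f#a₁ (c132 (fa₄a₁ H))
        a₂∈π : a₂ ∈ π
        a₂∈π with #? d a₁ | #? e a₄
        ... | inj₁ d#a₁ | _ = closed (u∈ A) a₁∈ d#a₁ (da₁a₂ H)
        ... | _ | inj₁ e#a₄ = closed (on-l A el) a₄∈π e#a₄ (ea₄a₂ H)
        ... | inj₂ Dda₁ | inj₂ Dea₄ = D∈′ (cross d#e (spread (l≢ dl (a₁∉l H)) Dda₁ (da₁a₂ H)) (spread (l≢ el (a₄∉l H)) Dea₄ (ea₄a₂ H)))
        a₃∈π : a₃ ∈ π
        a₃∈π with #? d a₄ | #? f a₂
        ... | inj₁ d#a₄ | _ = closed (u∈ A) a₄∈π d#a₄ (da₄a₃ H)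
        ... | _ | inj₁ f#a₂ = closed (v∈ A) a₂∈π f#a₂ (c132 (fa₃a₂ H))
        ... | inj₂ Dda₄ | inj₂ Dfa₂ = D∈′ (cross d#f (spread (l≢ dl (a₄∉l H)) Dda₄ (da₄a₃ H)) (spread (l≢ fl (a₂∉l H)) Dfa₂ (c132 (fa₃a₂ H))))

      coplanar₂ : Through l d f π → a₁ ∈ π → a₁ ≢ D → Col D f a₁ → a₂ ∈ π × a₃ ∈ π × a₄ ∈ π
      coplanar₂ {π} A a₁∈ a₁≢D Dfa₁ = a₂∈π , a₃∈π , a₄∈π
        where
        a₂∈π : a₂ ∈ π
        a₂∈π = closed (u∈ A) a₁∈ (#-sym (#-same a₁≢D Dfa₁ (#-sym d#f))) (da₁a₂ H)
        a₄∈π : a₄ ∈ π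
        a₄∈π with #? e a₂
        ... | inj₁ e#a₂ = closed (on-l A el) a₂∈π e#a₂ (c132 (ea₄a₂ H))
        ... | inj₂ Dea₂ = D∈′ (cross e#f (spread (l≢ el (a₂∉l H)) Dea₂ (c132 (ea₄a₂ H))) (spread (l≢ fl (a₁∉l H)) Dfa₁ (c132 (fa₄a₁ H))))
        a₃∈π : a₃ ∈ π
        a₃∈π with #? f a₂
        ... | inj₁ f#a₂ = closed (v∈ A) a₂∈π f#a₂ (c132 (fa₃a₂ H))
        -- The special line `f a₁` carries `a₄`; a special `f a₂` would be the same line.
        ... | inj₂ Dfa₂ = ⊥-elim (¬a₁a₂a₄ Q (on-line (l≢ fl (a₁∉l H)) c122 (on-line (≢-sym f≢D) c122 Dfa₁ Dfa₂) (c132 (fa₄a₁ H))))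

      placed : Placed l d f d e f a₁ a₂ a₃ a₄
      placed with a₁ ≟ D
      -- `plane-through` needs ordinary points, so `a₄` takes the place of `a₁` = `D`.
      ... | yes refl = case through (≢-sym (a₁≢a₄ Q)) (a₄∉l H) of λ { (π , A , a₄∈π) →
              let Dfa₄ = c312 (fa₄a₁ H) in
              record { thru = A ; conf = H ; d∈ = u∈ A ; e∈ = on-l A el ; f∈ = v∈ A ; a₁∈ = D∈
                     ; a₂∈ = closed (on-l A el) a₄∈π (#-sym (#-same (≢-sym (a₁≢a₄ Q)) Dfa₄ (#-sym e#f))) (ea₄a₂ H)
                     ; a₃∈ = closed (u∈ A) a₄∈π (#-sym (#-same (≢-sym (a₁≢a₄ Q)) Dfa₄ (#-sym d#f))) (da₄a₃ H) ; a₄∈ = a₄∈π } }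
      ... | no a₁≢D = case through a₁≢D (a₁∉l H) of λ { (π , A , a₁∈π) →
              let (a₂∈π , a₃∈π , a₄∈π) = rest A a₁∈π in
              record { thru = A ; conf = H ; d∈ = u∈ A ; e∈ = on-l A el ; f∈ = v∈ A ; a₁∈ = a₁∈π ; a₂∈ = a₂∈π ; a₃∈ = a₃∈π ; a₄∈ = a₄∈π } }
        where
        rest : Through l d f π → a₁ ∈ π → a₂ ∈ π × a₃ ∈ π × a₄ ∈ π
        rest A a₁∈ with #? f a₁
        ... | inj₁ f#a₁ = coplanar₁ A a₁∈ f#a₁
        ... | inj₂ Dfa₁ = coplanar₂ A a₁∈ a₁≢D Dfa₁

      conjugate-point : ∃[ h ] (h I l × Col h a₁ a₃)
      conjugate-point = case meet-in (a₁≢a₃ Q) d≢f (a₁∈ placed) (a₃∈ placed) (d∈ placed) (f∈ placed) of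
        λ { (h , _ , a₁a₃h , dfh) → h , col⇒I d≢f dl fl dfh , c312 a₁a₃h }

    -- The conjugate point is neither `d` nor `f`, as no three of the four points are collinear. If
    -- it were not `e` either, `l` would have four points, on four special lines.
    few⇒exists : ¬ ∃ (Separated {4}) → HarmonicConjugateExists l d e f
    few⇒exists few =
      case first-point fl dl (≢-sym d≢f) f≢D d≢D of λ { (c , c∉l , c#f) → case through (#⇒≢Dˡ c#f) c∉l of λ { (π , A , c∈) →
      case build D₃ dl el fl (u∈ A) (on-l A el) (v∈ A) c∈ c∉l c#f of λ { (c₂ , c₃ , c₄ , K , _) →
        e , record { configuration = c , c₂ , c₃ , c₄ , K ; conjugate = λ H → meet-axis (a₁∉l H) el (is-e H (conjugate-point H)) } } } }
      where
      is-e : ∀ {a₁ a₂ a₃ a₄} → HarmonicConfiguration l d e f a₁ a₂ a₃ a₄ → ∃[ h ] (h I l × Col h a₁ a₃) → Col e a₁ a₃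
      is-e {a₁} {a₂} {a₃} {a₄} H (h , hl , ha) with h ≟ d | h ≟ e | h ≟ f
      ... | _ | yes refl | _ = ha
      ... | yes refl | _ | _ = ⊥-elim (¬a₁a₂a₃ (quadrangle H) (on-line (λ { refl → a₁∉l H hl }) c122 (da₁a₂ H) ha))
      ... | _ | _ | yes refl = ⊥-elim (¬a₁a₃a₄ (quadrangle H) (on-line (λ { refl → a₁∉l H hl }) c122 ha (c132 (fa₄a₁ H))))
      ... | no h≢d | no h≢e | no h≢f = ⊥-elim (few (separate (h# dl h≢d) (h# el h≢e) (h# fl h≢f) d#e d#f e#f))
        where
        h# : ∀ {g} → g I l → h ≢ g → h # g
        h# gl = ord⇒# ord hl gl

    module _ (pick : Pick) (outside : ∀ π → ∃[ w ] w ∉ π) where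

      private
        share : Through l d f π → Through l d f π′ → x I l → x ∈ π → x ∈ π′
        share = share-ordinary ord d≢f dl fl

      -- If `a₁ a₄` is special, it is `D f`. At least one of `a₁`, `a₄` is not `D`, and `shift`
      -- takes it off that line.
      standard : ∀ {a₁ a₂ a₃ a₄} → HarmonicConfiguration l d e f a₁ a₂ a₃ a₄ → Standard l d f d e f a₁ a₃
      standard {a₁} {a₂} {a₃} {a₄} H with #? a₁ a₄
      ... | inj₁ a₁#a₄ = case conjugate-point H of λ { (h , hl , ha) → 
              record { at = placed H ; b₁#b₄ = a₁#a₄ ; h∈l = hl ; h∈ = on-l (thru (placed H)) hl ; hxy = ha ; hb₁b₃ = ha } }
      ... | inj₂ Da₁a₄ =
        case conjugate-point H of λ { (h , hl , ha) →
        case Axis.shift pick outside d≢f d≢D f≢D dl fl share (thru C) fl f≢D of λ { (π′ , A′ , φ , moved) →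
        case Iso.img φ (a₁∈ C) of λ { (b₁ , b₁∈ , φ₁) → case Iso.img φ (a₄∈ C) of λ { (b₄ , b₄∈ , φ₄) →
        case Conjugation.move-conf pick outside d≢f d≢D f≢D dl fl share C A′ φ φ₁ φ₄ b₁∈ b₄∈ of λ { (b₂ , b₃ , B , tr) →
          record
            { at = B
            ; b₁#b₄ = ordinary (conf B) (λ x≢D → moved (a₁∉l H) x≢D Dfa₁ φ₁) (λ x≢D → moved (a₄∉l H) x≢D Dfa₄ φ₄)
            ; h∈l = hl ; h∈ = on-l (thru B) hl ; hxy = ha ; hb₁b₃ = tr hl (on-l (thru C) hl) ha } } } } } }
        where
        C = placed H
        Q = quadrangle H
        Dfa₁ : Col D f a₁
        Dfa₁ = on-line (a₁≢a₄ Q) (c231 Da₁a₄) (c231 (c132 (fa₄a₁ H))) c121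
        Dfa₄ : Col D f a₄
        Dfa₄ = on-line (a₁≢a₄ Q) (c231 Da₁a₄) (c231 (c132 (fa₄a₁ H))) c122
        ordinary : ∀ {b₁ b₂ b₃ b₄} → HarmonicConfiguration l d e f b₁ b₂ b₃ b₄ →
                   (a₁ ≢ D → ¬ Col D f b₁) → (a₄ ≢ D → ¬ Col D f b₄) → b₁ # b₄
        ordinary K m₁ m₄ Db₁b₄ with a₁ ≟ D
        ... | no a₁≢D = m₁ a₁≢D (on-line (a₁≢a₄ (quadrangle K)) (c231 Db₁b₄) (c231 (c132 (fa₄a₁ K))) c121)
        ... | yes refl = m₄ (≢-sym (a₁≢a₄ Q)) (on-line (a₁≢a₄ (quadrangle K)) (c231 Db₁b₄) (c231 (c132 (fa₄a₁ K))) c122)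

      pick⇒exists : HarmonicConjugateExists l d e f
      pick⇒exists = case first-point fl dl (≢-sym d≢f) f≢D d≢D of λ { (c , c∉l , c#f) →
        Conjugation.exists pick outside d≢f d≢D f≢D dl fl share u∈ (λ A → on-l A el) v∈ D₃ dl el fl standard c∉l c#f }

  -- Conjugates on a special line

  module SpecialLine {l : Line} (sp : Special l) {d e f : Point} (D₃ : Distinct₃ d e f) (dl : d I l) (el : e I l) (fl : f I l)
    (f≢D : f ≢ D) where

    apart : ∀ {g} → g I l → g ≢ D → ¬ (x I l) → g # x
    apart gl g≢D x∉l Dgx = x∉l (col⇒I (≢-sym g≢D) sp gl Dgx)

    -- `g` is the one of `d` and `e` other than `D`, so every plane through `f` and `g` contains all
    -- of `d`, `e`, `f`.
    module _ {g : Point} (gl : g I l) (g≢D : g ≢ D) (f≢g : f ≢ g)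
      (d∈ₚ : ∀ {π} → Through l f g π → d ∈ π) (e∈ₚ : ∀ {π} → Through l f g π → e ∈ π)
      (a₂∈ₚ : ∀ {π a₁ a₂ a₃ a₄} → HarmonicConfiguration l d e f a₁ a₂ a₃ a₄ → Through l f g π → a₁ ∈ π → a₄ ∈ π → a₂ ∈ π) where

      through : x ≢ D → ¬ (x I l) → ∃[ π ] (Through l f g π × x ∈ π)
      through x≢D x∉l = case plane-through f≢D g≢D x≢D (λ fgx → x∉l (col⇒I f≢g fl gl fgx)) of λ { (π , f∈π , g∈π , x∈π) →
        π , record { u∈ = f∈π ; v∈ = g∈π ; w∈ = x∈π ; w∉l = x∉l ; w≢D = x≢D } , x∈π }

      some-configuration : ∃[ a₁ ] ∃[ a₂ ] ∃[ a₃ ] ∃[ a₄ ] HarmonicConfiguration l d e f a₁ a₂ a₃ a₄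
      some-configuration =
        case first-point fl gl f≢g f≢D g≢D of λ { (c , c∉l , c#f) → case through (#⇒≢Dˡ c#f) c∉l of λ { (π , A , c∈) →
        case build D₃ dl el fl (d∈ₚ A) (e∈ₚ A) (u∈ A) c∈ c∉l c#f of λ { (c₂ , c₃ , c₄ , K , _) → c , c₂ , c₃ , c₄ , K } } }

      module _ (pick : Pick) (outside : ∀ π → ∃[ w ] w ∉ π) where

        standard : ∀ {a₁ a₂ a₃ a₄} → HarmonicConfiguration l d e f a₁ a₂ a₃ a₄ → Standard l f g d e f a₁ a₃
        standard {a₁} {a₂} {a₃} {a₄} H =
          case through (#⇒≢Dʳ f#a₁) (a₁∉l H) of λ { (π , A , a₁∈π) →
          let a₄∈π : a₄ ∈ π
              a₄∈π = closed (u∈ A) a₁∈π f#a₁ (c132 (fa₄a₁ H))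
              a₂∈π : a₂ ∈ π
              a₂∈π = a₂∈ₚ H A a₁∈π a₄∈π
              a₃∈π : a₃ ∈ π
              a₃∈π = closed (u∈ A) a₂∈π (apart fl f≢D (a₂∉l H)) (c132 (fa₃a₂ H)) in
          case meet-in (a₁≢a₃ Q) f≢g a₁∈π a₃∈π (u∈ A) (v∈ A) of λ { (h , h∈π , a₁a₃h , fgh) →
          record
            { at = record { thru = A ; conf = H ; d∈ = d∈ₚ A ; e∈ = e∈ₚ A ; f∈ = u∈ A ; a₁∈ = a₁∈π ; a₂∈ = a₂∈π ; a₃∈ = a₃∈π ; a₄∈ = a₄∈π }
            ; b₁#b₄ = line# f#a₁ c122 (c132 (fa₄a₁ H)) (a₁≢a₄ Q)
            ; h∈l = col⇒I f≢g fl gl fgh ; h∈ = h∈π ; hxy = c312 a₁a₃h ; hb₁b₃ = c312 a₁a₃h } } }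
          where
          Q = quadrangle H
          f#a₁ : f # a₁
          f#a₁ = apart fl f≢D (a₁∉l H)

        pick⇒exists : HarmonicConjugateExists l d e f
        pick⇒exists = case first-point fl gl f≢g f≢D g≢D of λ { (c , c∉l , c#f) →
          Conjugation.exists pick outside f≢g f≢D g≢D fl gl (share-special pick outside sp f≢g f≢D g≢D fl gl)
            d∈ₚ e∈ₚ u∈ D₃ dl el fl standard c∉l c#f }

  -- Distinction by the position of `D` and the number of special lines

  Four : Set (ℓp ⊔ ℓl ⊔ ℓi)
  Four = ∃ (Separated {4})

  conjugate-ordinary : Nontrivial → ∀ {d e f} → Ordinary l → Distinct₃ d e f → d I l → e I l → f I l → HarmonicConjugateExists l d e f
  conjugate-ordinary nt ord D₃ dl el fl with em {P = Four}
  ... | yes (t , sep) = OrdinaryLine.pick⇒exists ord D₃ dl el fl (four⇒pick t sep) (nontrivial⇒outside nt)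
  ... | no few = OrdinaryLine.few⇒exists ord D₃ dl el fl few

  conjugate-d≡D : Nontrivial → ∀ {e f} → Distinct₃ D e f → D I l → e I l → f I l → HarmonicConjugateExists l D e f
  conjugate-d≡D {l} nt {e} {f} D₃@(D≢e , D≢f , e≢f) dl el fl with em {P = Four}
  ... | yes (t , sep) = pick⇒exists el (≢-sym D≢e) (≢-sym e≢f) (λ _ → D∈) v∈
          (λ H A _ a₄∈π → closed (v∈ A) a₄∈π (apart el (≢-sym D≢e) (a₄∉l H)) (ea₄a₂ H)) (four⇒pick t sep) (nontrivial⇒outside nt)
    where open SpecialLine dl D₃ dl el fl (≢-sym D≢f)
  ... | no few = e , record
          { configuration = some-configuration el (≢-sym D≢e) (≢-sym e≢f) (λ _ → D∈) v∈
              (λ H A _ a₄∈π → closed (v∈ A) a₄∈π (apart el (≢-sym D≢e) (a₄∉l H)) (ea₄a₂ H))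
          ; conjugate = λ H → meet-axis (a₁∉l H) el (Fano.e-on H) }
    where
    open SpecialLine dl D₃ dl el fl (≢-sym D≢f)
    -- By Veblen's axiom at `f`, the lines `a₁ a₃` and `a₄ a₂` meet in a point `g`. On `l` it can
    -- only be `e`; off `l`, the points `f`, `a₁`, `a₃`, `g` would lie on four special lines.
    module Fano {a₁ a₂ a₃ a₄ : Point} (H : HarmonicConfiguration l D e f a₁ a₂ a₃ a₄) where
      Q = quadrangle H
      f# : ¬ (x I l) → f # x
      f# = apart fl (≢-sym D≢f)
      D≢ : ¬ (x I l) → D ≢ x
      D≢ x∉l refl = x∉l dl
      a₁#a₃ : a₁ # a₃
      a₁#a₃ Da₁a₃ = ¬a₁a₂a₃ Q (on-line (D≢ (a₁∉l H)) c122 (da₁a₂ H) Da₁a₃)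
      e-on : Col e a₁ a₃
      e-on = case veblen (f# (a₁∉l H)) (f# (a₂∉l H)) c121 c121 c122 (c132 (fa₃a₂ H)) (a₁≢a₃ Q)
                    (c132 (fa₄a₁ H)) c122 (≢-sym (a₂≢a₄ Q)) of λ { (g , a₁a₃g , a₄a₂g) → finish a₁a₃g a₄a₂g }
        where
        finish : ∀ {g} → Col a₁ a₃ g → Col a₄ a₂ g → Col e a₁ a₃
        finish {g} a₁a₃g a₄a₂g with g I? l
        ... | yes gl with refl ← meets-axis el (a₄∉l H) (on-join c122 (ea₄a₂ H) (≢-sym (a₂≢a₄ Q)) a₄a₂g) gl = c312 a₁a₃g
        ... | no g∉l = ⊥-elim (few (separate (f# (a₁∉l H)) (f# (a₃∉l H)) (f# g∉l) a₁#a₃ a₁#g a₃#g))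
          where
          a₁#g : a₁ # g
          a₁#g Da₁g with g ≟ a₂
          ... | yes refl = ¬a₁a₂a₃ Q (c132 a₁a₃g)
          ... | no g≢a₂ = ¬a₁a₂a₄ Q (on-line (D≢ (a₁∉l H)) c122 (da₁a₂ H) (on-join Da₁g (da₁a₂ H) g≢a₂ (c321 a₄a₂g)))
          a₃#g : a₃ # g
          a₃#g Da₃g with g ≟ a₄
          ... | yes refl = ¬a₁a₃a₄ Q a₁a₃g
          ... | no g≢a₄ = ¬a₂a₃a₄ Q (on-line (D≢ (a₃∉l H)) (on-join Da₃g (c132 (da₄a₃ H)) g≢a₄ (c312 a₄a₂g)) c122 (c132 (da₄a₃ H)))

  conjugate-e≡D : Nontrivial → ∀ {d f} → Distinct₃ d D f → d I l → D I l → f I l → HarmonicConjugateExists l d D f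
  conjugate-e≡D {l} nt {d} {f} D₃@(d≢D , d≢f , D≢f) dl el fl with em {P = Four}
  ... | yes (t , sep) = pick⇒exists dl d≢D (≢-sym d≢f) v∈ (λ _ → D∈)
          (λ H A a₁∈π _ → closed (v∈ A) a₁∈π (apart dl d≢D (a₁∉l H)) (da₁a₂ H)) (four⇒pick t sep) (nontrivial⇒outside nt)
    where open SpecialLine el D₃ dl el fl (≢-sym D≢f)
  ... | no few = D , record
          { configuration = some-configuration dl d≢D (≢-sym d≢f) v∈ (λ _ → D∈)
              (λ H A a₁∈π _ → closed (v∈ A) a₁∈π (apart dl d≢D (a₁∉l H)) (da₁a₂ H))
          ; conjugate = λ H → meet-axis (a₁∉l H) el (D-on H) }
    where
    open SpecialLine el D₃ dl el fl (≢-sym D≢f)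
    -- If `a₁ a₃` missed `D`, the points `f`, `a₁`, `a₂`, `a₃` would lie on four special lines.
    D-on : ∀ {a₁ a₂ a₃ a₄} → HarmonicConfiguration l d D f a₁ a₂ a₃ a₄ → Col D a₁ a₃
    D-on {a₁} {a₂} {a₃} H with #? a₁ a₃
    ... | inj₂ Da₁a₃ = Da₁a₃
    ... | inj₁ a₁#a₃ = ⊥-elim (few (separate (f# (a₁∉l H)) (f# (a₂∉l H)) (f# (a₃∉l H))
            (line# (apart dl d≢D (a₁∉l H)) c122 (da₁a₂ H) (a₁≢a₂ (quadrangle H))) a₁#a₃
            (line# (f# (a₂∉l H)) c122 (c132 (fa₃a₂ H)) (a₂≢a₃ (quadrangle H)))))
      where
      f# : ¬ (x I l) → f # x
      f# = apart fl (≢-sym D≢f)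

theorem3p2 : ∀ {p ℓ i : Level} → ExcludedMiddle (p ⊔ ℓ ⊔ i) →
    (PR : ProjectiveRectangle p ℓ i) →
    let open ProjectiveRectangle PR in
    Nontrivial →
    (∀ {d e f} l → Ordinary l → Distinct₃ d e f →
    d I l → e I l → f I l →
    HarmonicConjugateExists l d e f)
    ×
    (∀ {d e f} l → (d ≡ D ⊎ e ≡ D ⊎ f ≡ D) → Distinct₃ d e f →
    d I l → e I l → f I l →
    HarmonicConjugateExists l d e f)
theorem3p2 em PR nt = (λ l → conjugate-ordinary nt) , λ
  { l (inj₁ refl) D₃ → conjugate-d≡D nt D₃
  ; l (inj₂ (inj₁ refl)) D₃ → conjugate-e≡D nt D₃
  ; l (inj₂ (inj₂ refl)) (d≢e , d≢f , e≢f) dl el fl →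
      swap-conjugate (conjugate-d≡D nt (≢-sym e≢f , ≢-sym d≢f , ≢-sym d≢e) fl el dl) }
  where open Rectangle em PR
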